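{- Let $n>1$ and let $\mathcal{G}$ be a class of goals such that if $H$ is a head of a rule then $K\in\mathcal{G}$ for any $K\subseteq H$ (multiset inclusion). There exists no acceptable encoding for qualified answers of $\mathrm{CHR}_{n+1}$ in $\mathrm{CHR}_n$ for the class $\mathcal{G}$.
   Context: **CHR.** Fix a signature whose predicate symbols are split into two disjoint sets $\Pi_b$ (built-in) and $\Pi_u$ (user-defined), and a first-order theory $CT$ giving the meaning of built-ins. Built-in constraints are given by $c::=a\mid c\wedge c\mid\exists_x c$ with $a$ an atomic formula over $\Pi_b$; a user-defined constraint is an atomic formula over $\Pi_u$. Conjunctions of atomic constraints are treated as multisets; "," denotes conjunction (multiset union); ${\tt true}$ is the empty multiset of built-in constraints. $Fv(\phi)$ is the set of free variables of $\phi$, and $\exists_{ -V}\phi$ is the existential closure of $\phi$ except for the variables in $V$. $p(\bar t)=p(\bar t')$ denotes the componentwise equalities $\bar t=\bar t'$ (undefined for different predicate symbols), extended in the expected way to multisets of constraints. A simplification rule has the form $H\Leftrightarrow C\mid B$ and a propagation rule the form $H\Rightarrow C\mid B$, where the head $H$ is a nonempty multiset of user-defined constraints, the guard $C$ a multiset of built-in constraints, and the body $B$ a multiset of constraints of both kinds. A program is a finite set of rules; a goal is a multiset of constraints of both kinds. Configurations are triples $\langle G,K,d\rangle$ ($G$ the constraints still to be solved, $K$ the accumulated user-defined constraints, $d$ a built-in constraint). For a program $P$, the relation $\longrightarrow$ is the least one such that: - Solve: $\langle (c,G),K,d\rangle\longrightarrow\langle G,K,d'\rangle$ if $c$ is built-in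 and $CT\models c\wedge d\leftrightarrow d'$; - Introduce: $\langle (h,G),K,d\rangle\longrightarrow\langle G,(h,K),d\rangle$ if $h$ is user-defined; - Simplify: $\langle G,H'\wedge K,d\rangle\longrightarrow\langle B\wedge G,K,H=H'\wedge d\rangle$ if $(H\Leftrightarrow C\mid B)\in P$, $x=Fv(H)$ and $CT\models d\rightarrow\exists_x((H=H')\wedge C)$; - Propagate: $\langle G,H'\wedge K,d\rangle\longrightarrow\langle B\wedge G,H'\wedge K,H=H'\wedge d\rangle$ if $(H\Rightarrow C\mid B)\in P$, $x=Fv(H)$ and $CT\models d\rightarrow\exists_x((H=H')\wedge C)$. In Simplify and Propagate the program rule is renamed with fresh variables. The qualified answers of $G$ in $P$ are $$\mathcal{QA}_P(G)=\{\exists_{ -Fv(G)}(K\wedge d)\mid \langle G,\emptyset,\emptyset\rangle\longrightarrow^*\langle\emptyset,K,d\rangle\not\longrightarrow\}.$$ Answers are read up to logical equivalence under $CT$ with respect to built-in constraints; multiplicity of user-defined constraints matters. **Dialects.** $\mathrm{CHR}_n$ is the CHR language where the number of atoms in the head of each rule is at most $n$. **Acceptable encodings for qualified answers.** For a CHR (sub)language $\mathrm{CHR}_x$ let $\mathcal{P}_x$ be the set of its programs and $\mathcal{G}_x$ the set of its possible goals (the user-defined predicates of source and target languages may differ). An acceptable encoding for qualified answers of $\mathrm{CHR}_x$ into $\mathrm{CHR}_y$ for the class of goals $\mathcal{G}$ is a pair of mappings $[\![\ ]\!]:\mathcal{P}_x\to\mathcal{P}_y$ and $[\![\ ]\!]_g:\mathcal{G}_x\to\mathcal{G}_y$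 such that: (1) $\mathcal{P}_x$ and $\mathcal{P}_y$ share the same $CT$; (2) for any goal $(A,B)\in\mathcal{G}_x$, $[\![A,B]\!]_g=[\![A]\!]_g,[\![B]\!]_g$, and the built-ins present in the goal are left unchanged; (3') for all $P\in\mathcal{P}_x$ and $G\in\mathcal{G}$, $\mathcal{QA}_P(G)=\mathcal{QA}_{[\![P]\!]}([\![G]\!]_g)$. -}

module Defs where

open import Level using (Level; 0ℓ; _⊔_) renaming (suc to lsuc)
open import Data.Nat using (ℕ; suc; _≤_; _≟_)
open import Data.Empty using (⊥)
open import Data.Unit using (⊤)
open import Data.Bool using (if_then_else_)
open import Data.Product using (∃-syntax; Σ-syntax; _×_; _,_)
open import Data.Sum using (_⊎_)
open import Data.Vec using (Vec; []; _∷_)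
open import Data.List using (List; []; _∷_; _++_; [_]; map; foldr; filter; concatMap)
open import Data.List.NonEmpty as List⁺ using (List⁺; toList)
open import Data.List.Membership.Propositional using (_∈_)
open import Data.List.Relation.Unary.All using (All)
open import Data.List.Relation.Unary.All.Properties using (++⁺)
open import Data.List.Relation.Binary.Disjoint.Propositional using (Disjoint)
open import Data.List.Relation.Binary.Permutation.Propositional using (_↭_)
open import Relation.Binary.PropositionalEquality using (_≡_)
open import Relation.Binary.Construct.Closure.ReflexiveTransitive using (Star)
open import Relation.Nullary using (¬_; does)
open import Relation.Nullary.Decidable using (¬?)
open import Function.Bundles using (_⇔_)
open import Function.Definitions using (Injective)

-- `User` is the common universe of user-defined predicate symbols; each CHR
-- language uses a subset of it (`UserPreds` below), so that source and target
-- languages may differ and still have comparable answers.  Equality is a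
-- logical symbol and is not listed in `Builtin`.
record Signature : Set₁ where
  field
    Fun      : Set
    funAr    : Fun → ℕ
    Builtin  : Set
    builtAr  : Builtin → ℕ
    User     : Set
    userAr   : User → ℕ

Var : Set
Var = ℕ

-- Multisets are lists up to _↭_.
module CHR (S : Signature) where
  open Signature S

  data Term : Set where
    var : Var → Term
    fun : (f : Fun) → Vec Term (funAr f) → Term

  data BAtom : Set where
    _≐_ : Term → Term → BAtom
    rel : (p : Builtin) → Vec Term (builtAr p) → BAtom

  infixr 6 _∧_
  infix  8 _≐_

  data BuiltIn : Set where
    true : BuiltIn
    atom : BAtom → BuiltIn
    _∧_  : BuiltIn → BuiltIn → BuiltIn
    ex   : Var → BuiltIn → BuiltIn

  data Atom : Set where
    usr : (p : User) → Vec Term (userAr p) → Atom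

  data Constraint : Set where
    builtin : BuiltIn → Constraint
    user    : Atom → Constraint

  ⋀ : List BuiltIn → BuiltIn
  ⋀ = foldr _∧_ true

  mutual
    fvTerm : Term → List Var
    fvTerm (var x)    = [ x ]
    fvTerm (fun f ts) = fvTerms ts

    fvTerms : ∀ {n} → Vec Term n → List Var
    fvTerms []       = []
    fvTerms (t ∷ ts) = fvTerm t ++ fvTerms ts

  fvBAtom : BAtom → List Var
  fvBAtom (s ≐ t)    = fvTerm s ++ fvTerm t
  fvBAtom (rel p ts) = fvTerms ts

  fvBuiltIn : BuiltIn → List Var
  fvBuiltIn true     = []
  fvBuiltIn (atom a) = fvBAtom a
  fvBuiltIn (c ∧ d)  = fvBuiltIn c ++ fvBuiltIn d
  fvBuiltIn (ex x c) = filter (λ y → ¬? (y ≟ x)) (fvBuiltIn c)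

  fvAtom : Atom → List Var
  fvAtom (usr p ts) = fvTerms ts

  fvConstraint : Constraint → List Var
  fvConstraint (builtin c) = fvBuiltIn c
  fvConstraint (user h)    = fvAtom h

  fvAtoms : List Atom → List Var
  fvAtoms = concatMap fvAtom

  fvConstraints : List Constraint → List Var
  fvConstraints = concatMap fvConstraint

  -- Renamings are applied to bound variables as well; this is capture-free
  -- because only injective renamings are ever used.
  mutual
    renTerm : (Var → Var) → Term → Term
    renTerm ρ (var x)    = var (ρ x)
    renTerm ρ (fun f ts) = fun f (renTerms ρ ts)

    renTerms : ∀ {n} → (Var → Var) → Vec Term n → Vec Term n
    renTerms ρ []       = []
    renTerms ρ (t ∷ ts) = renTerm ρ t ∷ renTerms ρ ts

  renBAtom : (Var → Var) → BAtom → BAtom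
  renBAtom ρ (s ≐ t)    = renTerm ρ s ≐ renTerm ρ t
  renBAtom ρ (rel p ts) = rel p (renTerms ρ ts)

  renBuiltIn : (Var → Var) → BuiltIn → BuiltIn
  renBuiltIn ρ true     = true
  renBuiltIn ρ (atom a) = atom (renBAtom ρ a)
  renBuiltIn ρ (c ∧ d)  = renBuiltIn ρ c ∧ renBuiltIn ρ d
  renBuiltIn ρ (ex x c) = ex (ρ x) (renBuiltIn ρ c)

  renAtom : (Var → Var) → Atom → Atom
  renAtom ρ (usr p ts) = usr p (renTerms ρ ts)

  renConstraint : (Var → Var) → Constraint → Constraint
  renConstraint ρ (builtin c) = builtin (renBuiltIn ρ c)
  renConstraint ρ (user h)    = user (renAtom ρ h)

  data Formula : Set where
    atomᶠ       : BAtom → Formula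
    ⊤ᶠ ⊥ᶠ       : Formula
    _∧ᶠ_ _∨ᶠ_   : Formula → Formula → Formula
    _⇒ᶠ_        : Formula → Formula → Formula
    ∀ᶠ ∃ᶠ       : Var → Formula → Formula

  infixr 6 _∧ᶠ_
  infixr 5 _∨ᶠ_
  infixr 4 _⇒ᶠ_
  infix  3 _⇔ᶠ_

  _⇔ᶠ_ : Formula → Formula → Formula
  φ ⇔ᶠ ψ = (φ ⇒ᶠ ψ) ∧ᶠ (ψ ⇒ᶠ φ)

  ∃ᶠ* : List Var → Formula → Formula
  ∃ᶠ* xs φ = foldr ∃ᶠ φ xs

  ⌜_⌝ : BuiltIn → Formula
  ⌜ true ⌝   = ⊤ᶠ
  ⌜ atom a ⌝ = atomᶠ a
  ⌜ c ∧ d ⌝  = ⌜ c ⌝ ∧ᶠ ⌜ d ⌝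
  ⌜ ex x c ⌝ = ∃ᶠ x ⌜ c ⌝

  record Structure : Set₁ where
    field
      Carrier  : Set
      nonempty : Carrier
      ⟦fun⟧    : (f : Fun) → Vec Carrier (funAr f) → Carrier
      ⟦rel⟧    : (p : Builtin) → Vec Carrier (builtAr p) → Set

  Valuation : Structure → Set
  Valuation M = Var → Structure.Carrier M

  _[_≔_] : ∀ {A : Set} → (Var → A) → Var → A → Var → A
  (σ [ x ≔ a ]) y = if does (y ≟ x) then a else σ y

  module _ (M : Structure) where
    open Structure M

    mutual
      eval : Valuation M → Term → Carrier
      eval σ (var x)    = σ x
      eval σ (fun f ts) = ⟦fun⟧ f (evals σ ts)

      evals : ∀ {n} → Valuation M → Vec Term n → Vec Carrier n
      evals σ []       = []
      evals σ (t ∷ ts) = eval σ t ∷ evals σ ts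

    holdsAtom : Valuation M → BAtom → Set
    holdsAtom σ (s ≐ t)    = eval σ s ≡ eval σ t
    holdsAtom σ (rel p ts) = ⟦rel⟧ p (evals σ ts)

    -- Tarskian truth.  The double negations on atoms, ∨ and ∃ make this the
    -- classical notion: every instance of excluded middle holds.
    Holds : Valuation M → Formula → Set
    Holds σ (atomᶠ a) = ¬ ¬ holdsAtom σ a
    Holds σ ⊤ᶠ        = ⊤
    Holds σ ⊥ᶠ        = ⊥
    Holds σ (φ ∧ᶠ ψ)  = Holds σ φ × Holds σ ψ
    Holds σ (φ ∨ᶠ ψ)  = ¬ ¬ (Holds σ φ ⊎ Holds σ ψ)
    Holds σ (φ ⇒ᶠ ψ)  = Holds σ φ → Holds σ ψ
    Holds σ (∀ᶠ x φ)  = ∀ a → Holds (σ [ x ≔ a ]) φ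
    Holds σ (∃ᶠ x φ)  = ¬ ¬ (∃[ a ] Holds (σ [ x ≔ a ]) φ)

  Theory : Set₁
  Theory = Formula → Set

  Model : Theory → Structure → Set
  Model CT M = ∀ φ → CT φ → ∀ σ → Holds M σ φ

  infix 2 _⊨_

  -- Free variables, in axioms and in consequences, are read as universally
  -- quantified.
  _⊨_ : Theory → Formula → Set₁
  CT ⊨ φ = ∀ M → Model CT M → ∀ σ → Holds M σ φ

  Consistent : Theory → Set₁
  Consistent CT = ¬ (CT ⊨ ⊥ᶠ)

  data RuleKind : Set where
    simplification propagation : RuleKind

  record Rule : Set where
    field
      kind  : RuleKind
      head  : List⁺ Atom
      guard : List BuiltIn
      body  : List Constraint

    heads : List Atom
    heads = toList head

  open Rule public

  fvRule : Rule → List Var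
  fvRule r = fvAtoms (heads r) ++ concatMap fvBuiltIn (guard r) ++ fvConstraints (body r)

  renRule : (Var → Var) → Rule → Rule
  renRule ρ r = record
    { kind  = kind r
    ; head  = List⁺.map (renAtom ρ) (head r)
    ; guard = map (renBuiltIn ρ) (guard r)
    ; body  = map (renConstraint ρ) (body r)
    }

  record FreshVariant (rs : List Rule) (avoid : List Var) (r : Rule) : Set where
    field
      original  : Rule
      member    : original ∈ rs
      ρ         : Var → Var
      injective : Injective _≡_ _≡_ ρ
      renamed   : r ≡ renRule ρ original
      fresh     : Disjoint (fvRule r) avoid

  eqs : ∀ {n} → Vec Term n → Vec Term n → BuiltIn
  eqs []       []         = true
  eqs (t ∷ ts) (t′ ∷ ts′) = atom (t ≐ t′) ∧ eqs ts ts′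

  -- H ≗ H′ ↦ e: the conjunction of equalities written H = H′ is defined
  -- (the predicate symbols agree position by position) and is e.
  infix 4 _≗_↦_
  data _≗_↦_ : List Atom → List Atom → BuiltIn → Set where
    nil  : [] ≗ [] ↦ true
    cons : ∀ {p ts ts′ H H′ e} →
           H ≗ H′ ↦ e →
           (usr p ts ∷ H) ≗ (usr p ts′ ∷ H′) ↦ (eqs ts ts′ ∧ e)

  record Config : Set where
    constructor ⟨_,_,_⟩
    field
      todo  : List Constraint
      store : List Atom
      built : BuiltIn

  fvConfig : Config → List Var
  fvConfig ⟨ G , K , d ⟩ = fvConstraints G ++ fvAtoms K ++ fvBuiltIn d

  Applicable : Theory → Rule → BuiltIn → BuiltIn → Set₁
  Applicable CT r e d =
    CT ⊨ ⌜ d ⌝ ⇒ᶠ ∃ᶠ* (fvAtoms (heads r)) (⌜ e ⌝ ∧ᶠ ⌜ ⋀ (guard r) ⌝)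

  -- V holds the free variables of the initial goal.  They have to be avoided
  -- when renaming rules even if they no longer occur in the configuration:
  -- Solve may replace the built-in store by an equivalent one in which they
  -- do not occur, but answers are not closed over them.
  data Step (CT : Theory) (rs : List Rule) (V : List Var) : Config → Config → Set₁ where
    solve : ∀ {G₀ G K c d d′} →
      G₀ ↭ builtin c ∷ G →
      CT ⊨ ⌜ c ⌝ ∧ᶠ ⌜ d ⌝ ⇔ᶠ ⌜ d′ ⌝ →
      Step CT rs V ⟨ G₀ , K , d ⟩ ⟨ G , K , d′ ⟩
    introduce : ∀ {G₀ G K h d} →
      G₀ ↭ user h ∷ G →
      Step CT rs V ⟨ G₀ , K , d ⟩ ⟨ G , h ∷ K , d ⟩
    simplify : ∀ {G K₀ H′ K d e r} →
      FreshVariant rs (V ++ fvConfig ⟨ G , K₀ , d ⟩) r →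
      kind r ≡ simplification →
      K₀ ↭ H′ ++ K →
      heads r ≗ H′ ↦ e →
      Applicable CT r e d →
      Step CT rs V ⟨ G , K₀ , d ⟩ ⟨ body r ++ G , K , e ∧ d ⟩
    propagate : ∀ {G K₀ H′ K d e r} →
      FreshVariant rs (V ++ fvConfig ⟨ G , K₀ , d ⟩) r →
      kind r ≡ propagation →
      K₀ ↭ H′ ++ K →
      heads r ≗ H′ ↦ e →
      Applicable CT r e d →
      Step CT rs V ⟨ G , K₀ , d ⟩ ⟨ body r ++ G , H′ ++ K , e ∧ d ⟩

  -- The answer ∃_{-visible}(store ∧ built).
  record Answer : Set where
    constructor ∃₋
    field
      visible : List Var
      store   : List Atom
      built   : BuiltIn

  QA : Theory → List Rule → List Constraint → Answer → Set₁
  QA CT rs G (∃₋ V K d) =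
      V ≡ fvConstraints G
    × Star (Step CT rs V) ⟨ G , [] , true ⟩ ⟨ [] , K , d ⟩
    × (∀ c → ¬ Step CT rs V ⟨ [] , K , d ⟩ c)

  GroundAtom : Structure → Set
  GroundAtom M = Σ[ p ∈ User ] Vec (Structure.Carrier M) (userAr p)

  ground : (M : Structure) → Valuation M → Atom → GroundAtom M
  ground M σ (usr p ts) = p , evals M σ ts

  -- Truth of an answer in M under σ, where the user-defined constraints are
  -- read as resources: the answer holds of the multiset k of ground atoms if,
  -- for some values of the non-visible variables, the built-in part is true
  -- and the user-defined part is exactly k.  (Ordinary truth would identify
  -- h ∧ h with h.)  The double negation makes the quantifier classical, as
  -- in Holds.
  HoldsOf : (M : Structure) → Valuation M → List (GroundAtom M) → Answer → Set
  HoldsOf M σ k (∃₋ V K d) =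
    ¬ ¬ (∃[ σ′ ] (∀ {x} → x ∈ V → σ′ x ≡ σ x)
               × Holds M σ′ ⌜ d ⌝
               × map (ground M σ′) K ↭ k)

  AnswerEquiv : Theory → Answer → Answer → Set₁
  AnswerEquiv CT a b =
    ∀ M → Model CT M → ∀ σ k → HoldsOf M σ k a ⇔ HoldsOf M σ k b

  AnswersIncluded : Theory → (A B : Answer → Set₁) → Set₁
  AnswersIncluded CT A B = ∀ a → A a → ∃[ b ] B b × AnswerEquiv CT a b

  SameAnswers : Theory → (A B : Answer → Set₁) → Set₁
  SameAnswers CT A B = AnswersIncluded CT A B × AnswersIncluded CT B A

  UserPreds : Set₁
  UserPreds = User → Set

  data AtomOver (Π : UserPreds) : Atom → Set where
    usr : ∀ {p ts} → Π p → AtomOver Π (usr p ts)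

  data ConstraintOver (Π : UserPreds) : Constraint → Set where
    builtin : ∀ {c} → ConstraintOver Π (builtin c)
    user    : ∀ {h} → AtomOver Π h → ConstraintOver Π (user h)

  -- r is a rule of CHRₙ with user-defined predicates Π.
  record RuleOf (Π : UserPreds) (n : ℕ) (r : Rule) : Set where
    field
      headOver : All (AtomOver Π) (heads r)
      bodyOver : All (ConstraintOver Π) (body r)
      headSize : List⁺.length (head r) ≤ n

  record Program (Π : UserPreds) (n : ℕ) : Set where
    field
      rules : List Rule
      wf    : All (RuleOf Π n) rules

  record Goal (Π : UserPreds) : Set where
    constructor goal
    field
      constraints : List Constraint
      wf          : All (ConstraintOver Π) constraints

  open Program public using (rules)
  open Goal public using (constraints)

  _⊕_ : ∀ {Π} → Goal Π → Goal Π → Goal Π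
  goal A a ⊕ goal B b = goal (A ++ B) (++⁺ a b)

  -- Every sub-multiset of a head of a rule of CHRₙ over Π belongs to 𝒢.
  ContainsSubheads : ∀ {ℓ} (Π : UserPreds) (n : ℕ) → (Goal Π → Set ℓ) → Set ℓ
  ContainsSubheads Π n 𝒢 =
    ∀ r → RuleOf Π n r →
    ∀ (K : Goal Π) (L : List Constraint) →
    constraints K ++ L ↭ map user (heads r) → 𝒢 K

  -- An acceptable encoding for qualified answers of CHRₓ over Πₛ into CHR_y
  -- over Πₜ for the class 𝒢.  The program mapping is not required to respect
  -- the identification of rule lists with the same elements.
  record AcceptableEncoding {ℓ} (CT : Theory) (Πₛ Πₜ : UserPreds) (x y : ℕ)
                            (𝒢 : Goal Πₛ → Set ℓ) : Set (lsuc 0ℓ ⊔ ℓ) where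
    field
      ⟦_⟧  : Program Πₛ x → Program Πₜ y
      ⟦_⟧ᵍ : Goal Πₛ → Goal Πₜ

      multiset : ∀ A B → constraints A ↭ constraints B →
                 constraints ⟦ A ⟧ᵍ ↭ constraints ⟦ B ⟧ᵍ

      compositional : ∀ A B →
        constraints ⟦ A ⊕ B ⟧ᵍ ↭ constraints ⟦ A ⟧ᵍ ++ constraints ⟦ B ⟧ᵍ

      builtinsUnchanged : ∀ A c → constraints A ≡ [ builtin c ] →
        constraints ⟦ A ⟧ᵍ ↭ [ builtin c ]

      preservesAnswers : ∀ P G → 𝒢 G →
        SameAnswers CT (QA CT (rules P) (constraints G))
                       (QA CT (rules ⟦ P ⟧) (constraints ⟦ G ⟧ᵍ))

{-# OPTIONS --safe #-}

-- Take the source program with the single rule h₀, …, h₀ ⇔ true | true, whose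
-- head consists of n + 1 copies of one atom h₀.  Every answer of the goal h₀ⁿ⁺¹
-- has lost these copies, whereas h₀ᵏ is its own only answer for k ≤ n.  In the
-- target, n + 1 renamed copies of a derivation for h₀ run side by side and reach
-- a store equivalent to h₀ⁿ⁺¹.  A rule applicable there has k ≤ n head atoms, so
-- it would also be applicable to the final configuration, equivalent to h₀ᵏ, of
-- the encoded h₀ᵏ.  Hence no rule is applicable, and that store is an answer of
-- the encoded h₀ⁿ⁺¹ which the source does not have.

module Submission where

open import Defs
open import Data.Nat using (ℕ; zero; suc; _+_; _∸_; _≤_; _<_; _>_; s≤s; _≟_; _<?_)
open import Data.Nat.Properties
open import Data.Empty using (⊥)
open import Data.Unit using (tt)
open import Data.Product using (∃; ∃-syntax; _×_; _,_; proj₁; proj₂)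
open import Data.Sum as Sum using (_⊎_; inj₁; inj₂; [_,_]′)
open import Data.Vec using (Vec; []; _∷_)
open import Data.List
  using (List; []; _∷_; _++_; [_]; map; concatMap; concat; length; replicate; reverse; _ʳ++_)
open import Data.List.Properties
  using (map-++; map-∘; map-cong; concatMap-++; ++-assoc; length-map; length-++; map-id;
         length-replicate; map-replicate; ∷-injectiveˡ; ∷-injectiveʳ)
open import Data.List.NonEmpty as List⁺ using (List⁺; _∷_)
open import Data.List.Membership.Propositional using (_∈_; _∉_)
open import Data.List.Membership.Propositional.Properties
open import Data.List.Membership.DecPropositional _≟_ using (_∈?_)
open import Data.List.Relation.Unary.All as All using (All; []; _∷_)
open import Data.List.Relation.Unary.Any as Any using (Any; here; there)
open import Data.List.Relation.Binary.Disjoint.Propositional using (Disjoint)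
open import Data.List.Relation.Binary.Pointwise using (Pointwise; []; _∷_)
open import Data.List.Relation.Binary.Permutation.Propositional
open import Data.List.Relation.Binary.Permutation.Propositional.Properties hiding (++-assoc)
open import Relation.Binary.PropositionalEquality
  using (_≡_; _≢_; refl; sym; cong; cong₂; subst; module ≡-Reasoning)
  renaming (trans to ≡-trans)
open import Relation.Binary.Construct.Closure.ReflexiveTransitive using (Star; ε; _◅_; _◅◅_)
open import Relation.Nullary using (¬_; yes; no; contradiction; Stable)
open import Relation.Nullary.Negation using (¬¬-map)
open import Relation.Nullary.Decidable using (¬?; decidable-stable; dec-true; dec-false)
open import Function.Base using (_∘_; id)
open import Function.Bundles using (_⇔_; Equivalence; mk⇔)
open import Function.Definitions using (Injective)
open import Data.List.Extrema.Nat using (max; xs≤max)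
import Data.List.Relation.Unary.All.Properties as Allₚ
import Data.List.Relation.Binary.Permutation.Propositional.Properties as Perm
import Data.Vec as Vec

-- The target answers need not contain `h₀` itself: their atoms may have other arguments and equal
-- `h₀` only in the light of a built-in store, with local variables, that differs from run to run.
-- Applicability therefore cannot be carried from one final configuration to another syntactically;
-- both are compared through the values of their atoms in models. A single repeated atom is what
-- makes this work: whichever k atoms a rule selects from the large store, their values are k times
-- that of `h₀`, which is exactly what the final store of the k-fold goal offers. The parallel runs
-- must agree on the variables of the goal and on nothing else, so local variables are shifted
-- apart, and valuations for the separate runs can then be glued together. Consistency is what makes
-- values informative, since without models any two answers would be equivalent. As truth is
-- classical by way of double negations, witnesses in models are available only under a double
-- negation, and the claims drawn from them are negative or stable.

module Semantics (S : Signature) where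
  open Signature S
  open CHR S

  -- Evaluation, free variables and renaming of syntax.

  mutual
    eval-cong : ∀ M {σ τ} t → (∀ {x} → x ∈ fvTerm t → σ x ≡ τ x) → eval M σ t ≡ eval M τ t
    eval-cong M (var x)    eq = eq (here refl)
    eval-cong M (fun f ts) eq = cong (Structure.⟦fun⟧ M f) (evals-cong M ts eq)

    evals-cong : ∀ M {σ τ n} (ts : Vec Term n) →
                 (∀ {x} → x ∈ fvTerms ts → σ x ≡ τ x) → evals M σ ts ≡ evals M τ ts
    evals-cong M []       eq = refl
    evals-cong M (t ∷ ts) eq =
      cong₂ _∷_ (eval-cong M t (eq ∘ ∈-++⁺ˡ)) (evals-cong M ts (eq ∘ ∈-++⁺ʳ (fvTerm t)))

  mutual
    eval-ren : ∀ M {σ} ρ t → eval M σ (renTerm ρ t) ≡ eval M (σ ∘ ρ) t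
    eval-ren M ρ (var x)    = refl
    eval-ren M ρ (fun f ts) = cong (Structure.⟦fun⟧ M f) (evals-ren M ρ ts)

    evals-ren : ∀ M {σ n} ρ (ts : Vec Term n) → evals M σ (renTerms ρ ts) ≡ evals M (σ ∘ ρ) ts
    evals-ren M ρ []       = refl
    evals-ren M ρ (t ∷ ts) = cong₂ _∷_ (eval-ren M ρ t) (evals-ren M ρ ts)

  mutual
    fvTerm-ren : ∀ ρ t → fvTerm (renTerm ρ t) ≡ map ρ (fvTerm t)
    fvTerm-ren ρ (var x)    = refl
    fvTerm-ren ρ (fun f ts) = fvTerms-ren ρ ts

    fvTerms-ren : ∀ ρ {n} (ts : Vec Term n) → fvTerms (renTerms ρ ts) ≡ map ρ (fvTerms ts)
    fvTerms-ren ρ []       = refl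
    fvTerms-ren ρ (t ∷ ts) =
      ≡-trans (cong₂ _++_ (fvTerm-ren ρ t) (fvTerms-ren ρ ts)) (sym (map-++ ρ (fvTerm t) _))

  mutual
    renTerm-∘ : ∀ ρ π t → renTerm ρ (renTerm π t) ≡ renTerm (ρ ∘ π) t
    renTerm-∘ ρ π (var x)    = refl
    renTerm-∘ ρ π (fun f ts) = cong (fun f) (renTerms-∘ ρ π ts)

    renTerms-∘ : ∀ ρ π {n} (ts : Vec Term n) → renTerms ρ (renTerms π ts) ≡ renTerms (ρ ∘ π) ts
    renTerms-∘ ρ π []       = refl
    renTerms-∘ ρ π (t ∷ ts) = cong₂ _∷_ (renTerm-∘ ρ π t) (renTerms-∘ ρ π ts)

  mutual
    renTerm-fixed : ∀ ρ t → (∀ {x} → x ∈ fvTerm t → ρ x ≡ x) → renTerm ρ t ≡ t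
    renTerm-fixed ρ (var x)    fix = cong var (fix (here refl))
    renTerm-fixed ρ (fun f ts) fix = cong (fun f) (renTerms-fixed ρ ts fix)

    renTerms-fixed : ∀ ρ {n} (ts : Vec Term n) → (∀ {x} → x ∈ fvTerms ts → ρ x ≡ x) → renTerms ρ ts ≡ ts
    renTerms-fixed ρ []       fix = refl
    renTerms-fixed ρ (t ∷ ts) fix =
      cong₂ _∷_ (renTerm-fixed ρ t (fix ∘ ∈-++⁺ˡ)) (renTerms-fixed ρ ts (fix ∘ ∈-++⁺ʳ (fvTerm t)))

  fvAtom-ren : ∀ ρ h → fvAtom (renAtom ρ h) ≡ map ρ (fvAtom h)
  fvAtom-ren ρ (usr p ts) = fvTerms-ren ρ ts

  fvAtoms-ren : ∀ ρ H → fvAtoms (map (renAtom ρ) H) ≡ map ρ (fvAtoms H)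
  fvAtoms-ren ρ []      = refl
  fvAtoms-ren ρ (h ∷ H) =
    ≡-trans (cong₂ _++_ (fvAtom-ren ρ h) (fvAtoms-ren ρ H)) (sym (map-++ ρ (fvAtom h) _))

  fvBAtom-ren : ∀ ρ a → fvBAtom (renBAtom ρ a) ≡ map ρ (fvBAtom a)
  fvBAtom-ren ρ (s ≐ t)    =
    ≡-trans (cong₂ _++_ (fvTerm-ren ρ s) (fvTerm-ren ρ t)) (sym (map-++ ρ (fvTerm s) _))
  fvBAtom-ren ρ (rel p ts) = fvTerms-ren ρ ts

  -- Only an inclusion: for a `ρ` that is not injective, the binder `ρ x` may capture further
  -- variables. Freshness arguments need no more than this direction.
  fvBuiltIn-ren : ∀ ρ c {y} → y ∈ fvBuiltIn (renBuiltIn ρ c) → y ∈ map ρ (fvBuiltIn c)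
  fvBuiltIn-ren ρ (atom a) {y} y∈ = subst (y ∈_) (fvBAtom-ren ρ a) y∈
  fvBuiltIn-ren ρ (c ∧ d)  {y} y∈ =
    subst (y ∈_) (sym (map-++ ρ (fvBuiltIn c) (fvBuiltIn d)))
      ([ ∈-++⁺ˡ ∘ fvBuiltIn-ren ρ c , ∈-++⁺ʳ (map ρ (fvBuiltIn c)) ∘ fvBuiltIn-ren ρ d ]′
        (∈-++⁻ (fvBuiltIn (renBuiltIn ρ c)) y∈))
  fvBuiltIn-ren ρ (ex x c) y∈
    with y∈c , y≢ρx ← ∈-filter⁻ (λ y → ¬? (y ≟ ρ x)) y∈
    with z , z∈ , refl ← ∈-map⁻ ρ (fvBuiltIn-ren ρ c y∈c)
    = ∈-map⁺ ρ (∈-filter⁺ (λ y → ¬? (y ≟ x)) z∈ λ z≡x → y≢ρx (cong ρ z≡x))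

  fvConstraint-ren : ∀ ρ c {y} → y ∈ fvConstraint (renConstraint ρ c) → y ∈ map ρ (fvConstraint c)
  fvConstraint-ren ρ (builtin c)  y∈ = fvBuiltIn-ren ρ c y∈
  fvConstraint-ren ρ (user h) {y} y∈ = subst (y ∈_) (fvAtom-ren ρ h) y∈

  concatMap-ren : ∀ {A : Set} (fv : A → List Var) (ren : A → A) ρ →
    (∀ a {y} → y ∈ fv (ren a) → y ∈ map ρ (fv a)) →
    ∀ as {y} → y ∈ concatMap fv (map ren as) → y ∈ map ρ (concatMap fv as)
  concatMap-ren fv ren ρ step (a ∷ as) {y} y∈ =
    subst (y ∈_) (sym (map-++ ρ (fv a) (concatMap fv as)))
      ([ ∈-++⁺ˡ ∘ step a , ∈-++⁺ʳ (map ρ (fv a)) ∘ concatMap-ren fv ren ρ step as ]′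
        (∈-++⁻ (fv (ren a)) y∈))

  fvRule-ren : ∀ ρ r {y} → y ∈ fvRule (renRule ρ r) → y ∈ map ρ (fvRule r)
  fvRule-ren ρ r {y} y∈ =
    subst (y ∈_) (sym (≡-trans (map-++ ρ fvH (fvC ++ fvB)) (cong (map ρ fvH ++_) (map-++ ρ fvC fvB))))
      ([ ∈-++⁺ˡ ∘ subst (y ∈_) (fvAtoms-ren ρ (heads r))
       , ∈-++⁺ʳ (map ρ fvH) ∘
         [ ∈-++⁺ˡ ∘ concatMap-ren fvBuiltIn (renBuiltIn ρ) ρ (fvBuiltIn-ren ρ) (guard r)
         , ∈-++⁺ʳ (map ρ fvC) ∘ concatMap-ren fvConstraint (renConstraint ρ) ρ (fvConstraint-ren ρ) (body r)
         ]′ ∘ ∈-++⁻ (concatMap fvBuiltIn (guard (renRule ρ r)))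
       ]′ (∈-++⁻ (fvAtoms (heads (renRule ρ r))) y∈))
    where
    fvH = fvAtoms (heads r)
    fvC = concatMap fvBuiltIn (guard r)
    fvB = fvConstraints (body r)

  renAtom-∘ : ∀ ρ π h → renAtom ρ (renAtom π h) ≡ renAtom (ρ ∘ π) h
  renAtom-∘ ρ π (usr p ts) = cong (usr p) (renTerms-∘ ρ π ts)

  renBuiltIn-∘ : ∀ ρ π c → renBuiltIn ρ (renBuiltIn π c) ≡ renBuiltIn (ρ ∘ π) c
  renBuiltIn-∘ ρ π true              = refl
  renBuiltIn-∘ ρ π (atom (s ≐ t))    = cong₂ (λ s t → atom (s ≐ t)) (renTerm-∘ ρ π s) (renTerm-∘ ρ π t)
  renBuiltIn-∘ ρ π (atom (rel p ts)) = cong (atom ∘ rel p) (renTerms-∘ ρ π ts)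
  renBuiltIn-∘ ρ π (c ∧ d)           = cong₂ _∧_ (renBuiltIn-∘ ρ π c) (renBuiltIn-∘ ρ π d)
  renBuiltIn-∘ ρ π (ex x c)          = cong (ex _) (renBuiltIn-∘ ρ π c)

  renConstraint-∘ : ∀ ρ π c → renConstraint ρ (renConstraint π c) ≡ renConstraint (ρ ∘ π) c
  renConstraint-∘ ρ π (builtin c) = cong builtin (renBuiltIn-∘ ρ π c)
  renConstraint-∘ ρ π (user h)    = cong user (renAtom-∘ ρ π h)

  mkRule : RuleKind → List⁺ Atom → List BuiltIn → List Constraint → Rule
  mkRule k h g b = record { kind = k ; head = h ; guard = g ; body = b }

  renRule-∘ : ∀ ρ π r → renRule ρ (renRule π r) ≡ renRule (ρ ∘ π) r
  renRule-∘ ρ π r = mkRule-cong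
    (cong₂ _∷_ (renAtom-∘ ρ π (List⁺.head (head r))) (maps (renAtom-∘ ρ π) (List⁺.tail (head r))))
    (maps (renBuiltIn-∘ ρ π) (guard r))
    (maps (renConstraint-∘ ρ π) (body r))
    where
    maps : ∀ {A : Set} {f g h : A → A} → (∀ a → f (g a) ≡ h a) → ∀ as → map f (map g as) ≡ map h as
    maps eq as = ≡-trans (sym (map-∘ as)) (map-cong eq as)

    mkRule-cong : ∀ {h h′ g g′ b b′} → h ≡ h′ → g ≡ g′ → b ≡ b′ →
                  mkRule (kind r) h g b ≡ mkRule (kind r) h′ g′ b′
    mkRule-cong refl refl refl = refl

  -- Injective renamings compose. Disjointness is supplied anew because each use has its own
  -- variables to avoid.
  FreshVariant-ren : ∀ {rs W W′ r ρ} → FreshVariant rs W r → Injective _≡_ _≡_ ρ →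
    Disjoint (fvRule (renRule ρ r)) W′ → FreshVariant rs W′ (renRule ρ r)
  FreshVariant-ren {ρ = ρ} v inj disj = record
    { original  = original
    ; member    = member
    ; ρ         = ρ ∘ π
    ; injective = injective ∘ inj
    ; renamed   = ≡-trans (cong (renRule ρ) renamed) (renRule-∘ ρ π original)
    ; fresh     = disj
    } where open FreshVariant v renaming (ρ to π)

  -- Satisfaction of built-in constraints.

  Sat : ∀ M → Valuation M → BuiltIn → Set
  Sat M σ c = Holds M σ ⌜ c ⌝

  ≔-same : ∀ {A : Set} (σ : Var → A) x a {y} → y ≡ x → (σ [ x ≔ a ]) y ≡ a
  ≔-same σ x a {y} y≡x rewrite dec-true (y ≟ x) y≡x = refl

  ≔-other : ∀ {A : Set} (σ : Var → A) x a {y} → y ≢ x → (σ [ x ≔ a ]) y ≡ σ y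
  ≔-other σ x a {y} y≢x rewrite dec-false (y ≟ x) y≢x = refl

  ≔-cong : ∀ {A : Set} (σ τ : Var → A) x a {y} → (y ≢ x → σ y ≡ τ y) → (σ [ x ≔ a ]) y ≡ (τ [ x ≔ a ]) y
  ≔-cong σ τ x a {y} eq with y ≟ x
  ... | yes y≡x = ≡-trans (≔-same σ x a y≡x) (sym (≔-same τ x a y≡x))
  ... | no  y≢x = ≡-trans (≔-other σ x a y≢x) (≡-trans (eq y≢x) (sym (≔-other τ x a y≢x)))

  ≔-ren : ∀ {A : Set} (σ τ : Var → A) ρ x a → Injective _≡_ _≡_ ρ → (∀ y → τ y ≡ σ (ρ y)) →
          ∀ y → (τ [ x ≔ a ]) y ≡ (σ [ ρ x ≔ a ]) (ρ y)
  ≔-ren σ τ ρ x a inj eq y with y ≟ x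
  ... | yes y≡x = ≡-trans (≔-same τ x a y≡x) (sym (≔-same σ (ρ x) a (cong ρ y≡x)))
  ... | no  y≢x = ≡-trans (≔-other τ x a y≢x) (≡-trans (eq y) (sym (≔-other σ (ρ x) a (y≢x ∘ inj))))

  holdsAtom-cong : ∀ M {σ τ} a → (∀ {x} → x ∈ fvBAtom a → σ x ≡ τ x) → holdsAtom M σ a → holdsAtom M τ a
  holdsAtom-cong M (s ≐ t) eq p =
    ≡-trans (sym (eval-cong M s (eq ∘ ∈-++⁺ˡ))) (≡-trans p (eval-cong M t (eq ∘ ∈-++⁺ʳ (fvTerm s))))
  holdsAtom-cong M (rel p ts) eq = subst (Structure.⟦rel⟧ M p) (evals-cong M ts eq)

  Sat-cong : ∀ M {σ τ} c → (∀ {x} → x ∈ fvBuiltIn c → σ x ≡ τ x) → Sat M σ c → Sat M τ c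
  Sat-cong M true     eq s         = tt
  Sat-cong M (atom a) eq s         = ¬¬-map (holdsAtom-cong M a eq) s
  Sat-cong M (c ∧ d)  eq (sc , sd) =
    Sat-cong M c (eq ∘ ∈-++⁺ˡ) sc , Sat-cong M d (eq ∘ ∈-++⁺ʳ (fvBuiltIn c)) sd
  Sat-cong M {σ} {τ} (ex x c) eq s = ¬¬-map (λ where
    (a , sa) → a , Sat-cong M c (λ y∈ → ≔-cong σ τ x a λ y≢x → eq (∈-filter⁺ (λ y → ¬? (y ≟ x)) y∈ y≢x)) sa) s

  -- The double negations on atoms and `ex` leave no positive information in a built-in, so a
  -- witness known only up to double negation is good enough to establish one.
  Sat-stable : ∀ M σ c → Stable (Sat M σ c)
  Sat-stable M σ true     s   = tt
  Sat-stable M σ (atom a) s k = s λ s → s k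
  Sat-stable M σ (c ∧ d)  s   = Sat-stable M σ c (¬¬-map proj₁ s) , Sat-stable M σ d (¬¬-map proj₂ s)
  Sat-stable M σ (ex x c) s k = s λ s → s k

  holdsAtom-ren : ∀ M {σ} ρ a → holdsAtom M σ (renBAtom ρ a) ≡ holdsAtom M (σ ∘ ρ) a
  holdsAtom-ren M ρ (s ≐ t)    = cong₂ _≡_ (eval-ren M ρ s) (eval-ren M ρ t)
  holdsAtom-ren M ρ (rel p ts) = cong (Structure.⟦rel⟧ M p) (evals-ren M ρ ts)

  -- Binders are renamed as well; by injectivity the update at `ρ x` affects no image of a variable
  -- other than `x`.
  Sat-ren⁺ : ∀ M {σ ρ} → Injective _≡_ _≡_ ρ → ∀ c → Sat M (σ ∘ ρ) c → Sat M σ (renBuiltIn ρ c)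
  Sat-ren⁺ M {ρ = ρ} inj true     s         = tt
  Sat-ren⁺ M {ρ = ρ} inj (atom a) s         = subst (λ A → ¬ ¬ A) (sym (holdsAtom-ren M ρ a)) s
  Sat-ren⁺ M {ρ = ρ} inj (c ∧ d)  (sc , sd) = Sat-ren⁺ M inj c sc , Sat-ren⁺ M inj d sd
  Sat-ren⁺ M {σ} {ρ} inj (ex x c) s    = ¬¬-map (λ where
    (a , sa) → a , Sat-ren⁺ M inj c (Sat-cong M c (λ {y} _ → ≔-ren σ (σ ∘ ρ) ρ x a inj (λ _ → refl) y) sa)) s

  Sat-ren⁻ : ∀ M {σ ρ} → Injective _≡_ _≡_ ρ → ∀ c → Sat M σ (renBuiltIn ρ c) → Sat M (σ ∘ ρ) c
  Sat-ren⁻ M {ρ = ρ} inj true     s         = tt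
  Sat-ren⁻ M {ρ = ρ} inj (atom a) s         = subst (λ A → ¬ ¬ A) (holdsAtom-ren M ρ a) s
  Sat-ren⁻ M {ρ = ρ} inj (c ∧ d)  (sc , sd) = Sat-ren⁻ M inj c sc , Sat-ren⁻ M inj d sd
  Sat-ren⁻ M {σ} {ρ} inj (ex x c) s    = ¬¬-map (λ where
    (a , sa) → a , Sat-cong M c (λ {y} _ → sym (≔-ren σ (σ ∘ ρ) ρ x a inj (λ _ → refl) y)) (Sat-ren⁻ M inj c sa)) s

  -- Each quantifier is instantiated with the value under `τ`, so a variable listed several times
  -- receives the same value every time.
  ∃ᶠ*-intro : ∀ M {σ τ} xs c → (∀ {y} → y ∉ xs → τ y ≡ σ y) → Sat M τ c → Holds M σ (∃ᶠ* xs ⌜ c ⌝)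
  ∃ᶠ*-intro M []       c eq s = Sat-cong M c (λ _ → eq λ ()) s
  ∃ᶠ*-intro M {σ} {τ} (x ∷ xs) c eq s k = k (τ x , ∃ᶠ*-intro M xs c (λ {y} → agree {y}) s)
    where
    agree : ∀ {y} → y ∉ xs → τ y ≡ (σ [ x ≔ τ x ]) y
    agree {y} y∉ with y ≟ x
    ... | yes refl = sym (≔-same σ x (τ x) refl)
    ... | no y≢x   = ≡-trans (eq λ { (here y≡x) → y≢x y≡x ; (there y∈) → y∉ y∈ }) (sym (≔-other σ x (τ x) y≢x))

  ∃ᶠ*-elim : ∀ M {σ} xs c → Holds M σ (∃ᶠ* xs ⌜ c ⌝) →
             ¬ ¬ (∃[ τ ] (∀ {y} → y ∉ xs → τ y ≡ σ y) × Sat M τ c)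
  ∃ᶠ*-elim M []       c s k = k (_ , (λ _ → refl) , s)
  ∃ᶠ*-elim M {σ} (x ∷ xs) c s k = s λ (a , sa) → ∃ᶠ*-elim M xs c sa λ (τ , eq , sτ) →
    k (τ , (λ y∉ → ≡-trans (eq (y∉ ∘ there)) (≔-other σ x a (y∉ ∘ here))) , sτ)

  -- A separate `τ` in place of `σ ∘ ρ` lets the induction pass a quantifier: after the updates the
  -- two valuations agree only pointwise.
  ∃ᶠ*-ren : ∀ M {σ τ ρ} → Injective _≡_ _≡_ ρ → (∀ y → τ y ≡ σ (ρ y)) → ∀ xs c →
            Holds M τ (∃ᶠ* xs ⌜ c ⌝) → Holds M σ (∃ᶠ* (map ρ xs) ⌜ renBuiltIn ρ c ⌝)
  ∃ᶠ*-ren M inj eq []       c s = Sat-ren⁺ M inj c (Sat-cong M c (λ {y} _ → eq y) s)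
  ∃ᶠ*-ren M {σ} {τ} {ρ} inj eq (x ∷ xs) c s =
    ¬¬-map (λ (a , sa) → a , ∃ᶠ*-ren M inj (≔-ren σ τ ρ x a inj eq) xs c sa) s

  -- Ground atoms and matching.

  predicate : Atom → User
  predicate (usr p _) = p

  ground-cong : ∀ M {σ τ} h → (∀ {x} → x ∈ fvAtom h → σ x ≡ τ x) → ground M σ h ≡ ground M τ h
  ground-cong M (usr p ts) eq = cong (p ,_) (evals-cong M ts eq)

  ground-ren : ∀ M {σ} ρ h → ground M σ (renAtom ρ h) ≡ ground M (σ ∘ ρ) h
  ground-ren M ρ (usr p ts) = cong (p ,_) (evals-ren M ρ ts)

  grounds-cong : ∀ M {σ τ} H → (∀ {x} → x ∈ fvAtoms H → σ x ≡ τ x) → map (ground M σ) H ≡ map (ground M τ) H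
  grounds-cong M []      eq = refl
  grounds-cong M (h ∷ H) eq =
    cong₂ _∷_ (ground-cong M h (eq ∘ ∈-++⁺ˡ)) (grounds-cong M H (eq ∘ ∈-++⁺ʳ (fvAtom h)))

  grounds-ren : ∀ M {σ} ρ H → map (ground M σ) (map (renAtom ρ) H) ≡ map (ground M (σ ∘ ρ)) H
  grounds-ren M ρ []      = refl
  grounds-ren M ρ (h ∷ H) = cong₂ _∷_ (ground-ren M ρ h) (grounds-ren M ρ H)

  ground-predicate : ∀ M σ h → proj₁ (ground M σ h) ≡ predicate h
  ground-predicate M σ (usr p ts) = refl

  ≗↦-predicates : ∀ {H L e} → H ≗ L ↦ e → map predicate H ≡ map predicate L
  ≗↦-predicates nil      = refl
  ≗↦-predicates (cons m) = cong (_ ∷_) (≗↦-predicates m)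

  ≗↦-length : ∀ {H L e} → H ≗ L ↦ e → length H ≡ length L
  ≗↦-length nil      = refl
  ≗↦-length (cons m) = cong suc (≗↦-length m)

  -- Definedness of `H = L` depends on the predicate symbols alone, so a match can be set up against
  -- atoms whose arguments are known only semantically.
  ≗↦-total : ∀ H L → map predicate H ≡ map predicate L → ∃[ e ] H ≗ L ↦ e
  ≗↦-total []             []             eq = _ , nil
  ≗↦-total (usr p ts ∷ H) (usr q us ∷ L) eq
    with refl ← ∷-injectiveˡ eq
    with e , m ← ≗↦-total H L (∷-injectiveʳ eq)
    = _ , cons m

  ≗↦-ren : ∀ {H L e} ρ → H ≗ L ↦ e → map (renAtom ρ) H ≗ map (renAtom ρ) L ↦ renBuiltIn ρ e
  ≗↦-ren ρ nil = nil
  ≗↦-ren ρ (cons {p = p} {ts} {us} {e = e} m) =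
    subst (λ c → _ ≗ _ ↦ (c ∧ renBuiltIn ρ e)) (eqs-ren ts us) (cons (≗↦-ren ρ m))
    where
    eqs-ren : ∀ {n} (ts us : Vec Term n) → eqs (renTerms ρ ts) (renTerms ρ us) ≡ renBuiltIn ρ (eqs ts us)
    eqs-ren []       []       = refl
    eqs-ren (t ∷ ts) (u ∷ us) = cong (_ ∧_) (eqs-ren ts us)

  eqs-sound : ∀ M {σ n} (ts us : Vec Term n) → Sat M σ (eqs ts us) → ¬ ¬ (evals M σ ts ≡ evals M σ us)
  eqs-sound M []       []       s       k = k refl
  eqs-sound M (t ∷ ts) (u ∷ us) (s , s′) k = s λ eq → eqs-sound M ts us s′ λ eq′ → k (cong₂ _∷_ eq eq′)

  eqs-complete : ∀ M {σ n} (ts us : Vec Term n) → evals M σ ts ≡ evals M σ us → Sat M σ (eqs ts us)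
  eqs-complete M []       []       eq = tt
  eqs-complete M (t ∷ ts) (u ∷ us) eq =
    (λ k → k (cong (λ { (v ∷ _) → v }) eq)) , eqs-complete M ts us (cong (λ { (_ ∷ vs) → vs }) eq)

  ≗↦-sound : ∀ M {σ H L e} → H ≗ L ↦ e → Sat M σ e → ¬ ¬ (map (ground M σ) H ≡ map (ground M σ) L)
  ≗↦-sound M nil s k = k refl
  ≗↦-sound M (cons {ts = ts} {us} m) (s , s′) k =
    eqs-sound M ts us s λ eq → ≗↦-sound M m s′ λ eq′ → k (cong₂ _∷_ (cong (_ ,_) eq) eq′)

  ≗↦-complete : ∀ M {σ H L e} → H ≗ L ↦ e → map (ground M σ) H ≡ map (ground M σ) L → Sat M σ e
  ≗↦-complete M nil eq = tt
  ≗↦-complete M {σ} (cons {p = p} {ts} {us} m) eq =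
    eqs-complete M ts us (cancel (∷-injectiveˡ eq)) ,
    ≗↦-complete M m (∷-injectiveʳ eq)
    where
    -- The vectors have a type depending on `p`, so this match on `refl` rests on axiom K.
    cancel : ∀ {vs ws : Vec (Structure.Carrier M) (userAr p)} →
             _≡_ {A = GroundAtom M} (p , vs) (p , ws) → vs ≡ ws
    cancel refl = refl

-- Running a renamed derivation inside a larger configuration.

module Derivations (S : Signature) where
  open Signature S
  open CHR S
  open Semantics S

  permute-Pointwise : ∀ {a r} {A B : Set a} {R : A → B → Set r} {xs xs′ ys} →
    Pointwise R xs ys → xs ↭ xs′ → ∃[ ys′ ] ys ↭ ys′ × Pointwise R xs′ ys′
  permute-Pointwise rs           refl         = _ , refl , rs
  permute-Pointwise (r ∷ rs)     (prep x p)   with _ , q , rs′ ← permute-Pointwise rs p =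
    _ , prep _ q , r ∷ rs′
  permute-Pointwise (r ∷ s ∷ rs) (swap x y p) with _ , q , rs′ ← permute-Pointwise rs p =
    _ , swap _ _ q , s ∷ r ∷ rs′
  permute-Pointwise rs           (trans p p′)
    with _ , q , rs′ ← permute-Pointwise rs p
    with _ , q′ , rs″ ← permute-Pointwise rs′ p′ = _ , trans q q′ , rs″

  map-constant : ∀ {A B : Set} {f : A → B} {b xs} →
                 All (λ x → f x ≡ b) xs → map f xs ≡ replicate (length xs) b
  map-constant []         = refl
  map-constant (eq ∷ eqs) = cong₂ _∷_ eq (map-constant eqs)

  concatMap-resp-↭ : ∀ {A : Set} (f : A → List Var) {xs ys} → xs ↭ ys →
                     ∀ {y} → y ∈ concatMap f xs → y ∈ concatMap f ys
  concatMap-resp-↭ f {xs} p = ∈-concatMap⁺ f ∘ Any-resp-↭ p ∘ ∈-concatMap⁻ f {xs = xs}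

  concatMap-++⁻ : ∀ {A : Set} (f : A → List Var) xs ys →
                  ∀ {y} → y ∈ concatMap f (xs ++ ys) → y ∈ concatMap f xs ⊎ y ∈ concatMap f ys
  concatMap-++⁻ f xs ys {y} y∈ = ∈-++⁻ (concatMap f xs) (subst (y ∈_) (concatMap-++ f xs ys) y∈)

  ⋀-ren : ∀ ρ g → ⋀ (map (renBuiltIn ρ) g) ≡ renBuiltIn ρ (⋀ g)
  ⋀-ren ρ []      = refl
  ⋀-ren ρ (c ∷ g) = cong (renBuiltIn ρ c ∧_) (⋀-ren ρ g)

  fv-⋀ : ∀ g → fvBuiltIn (⋀ g) ≡ concatMap fvBuiltIn g
  fv-⋀ []      = refl
  fv-⋀ (c ∷ g) = cong (fvBuiltIn c ++_) (fv-⋀ g)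

  -- A derivation is simulated, with its variables renamed, inside a larger
  -- configuration.  Pending built-ins are related semantically: those of the
  -- initial goal are left alone, including their bound variables, whereas
  -- renConstraint would change the latter.
  module Simulation
    (CT : Theory) (rs : List Rule) (V V′ : List Var) (ρ : Var → Var) (inj : Injective _≡_ _≡_ ρ)
    (G₂ : List Constraint) (K₂ : List Atom) (f : BuiltIn)
    (away : ∀ {x} → x ∉ V → ρ x ∉ V′ ++ fvConfig ⟨ G₂ , K₂ , f ⟩) where

    data Renamed : Constraint → Constraint → Set₁ where
      builtin : ∀ {c c̃} → (∀ M σ → Sat M σ c̃ ⇔ Sat M (σ ∘ ρ) c) →
                (∀ {y} → y ∈ fvBuiltIn c̃ → y ∈ map ρ (fvBuiltIn c)) → Renamed (builtin c) (builtin c̃)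
      user    : ∀ {h} → Renamed (user h) (user (renAtom ρ h))

    renConstraint-Renamed : ∀ c → Renamed c (renConstraint ρ c)
    renConstraint-Renamed (builtin c) =
      builtin (λ M σ → mk⇔ (Sat-ren⁻ M inj c) (Sat-ren⁺ M inj c)) (fvBuiltIn-ren ρ c)
    renConstraint-Renamed (user h)    = user

    fixed-Renamed : ∀ c → (∀ {x} → x ∈ fvConstraint c → ρ x ≡ x) → Renamed c c
    fixed-Renamed (builtin c) fix = builtin
      (λ M σ → mk⇔ (Sat-cong M c (λ y∈ → sym (cong σ (fix y∈)))) (Sat-cong M c (λ y∈ → cong σ (fix y∈))))
      (λ {y} y∈ → subst (_∈ map ρ (fvBuiltIn c)) (fix y∈) (∈-map⁺ ρ y∈))
    fixed-Renamed (user (usr p ts)) fix =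
      subst (λ us → Renamed (user (usr p ts)) (user (usr p us))) (renTerms-fixed ρ ts fix) user

    Renamed-fv : ∀ {G G̃} → Pointwise Renamed G G̃ → ∀ {y} → y ∈ fvConstraints G̃ → y ∈ map ρ (fvConstraints G)
    Renamed-fv {c ∷ G} {c̃ ∷ G̃} (r ∷ rs) {y} y∈ =
      subst (y ∈_) (sym (map-++ ρ (fvConstraint c) (fvConstraints G)))
        ([ ∈-++⁺ˡ ∘ one r , ∈-++⁺ʳ (map ρ (fvConstraint c)) ∘ Renamed-fv rs ]′ (∈-++⁻ (fvConstraint c̃) y∈))
      where
      one : ∀ {c c̃} → Renamed c c̃ → ∀ {y} → y ∈ fvConstraint c̃ → y ∈ map ρ (fvConstraint c)
      one (builtin _ fv)     y∈ = fv y∈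
      one (user {h = h}) {y} y∈ = subst (y ∈_) (fvAtom-ren ρ h) y∈

    -- Built-in stores are compared by truth because Solve may rewrite them freely. Their variables
    -- are bounded separately, since freshness of rules is syntactic and equivalence does not
    -- control it.
    record Simulates (c c̃ : Config) : Set₁ where
      private
        module C = Config c
        module C̃ = Config c̃
      field
        {todoρ}   : List Constraint
        todo      : C̃.todo ↭ todoρ ++ G₂
        pointwise : Pointwise Renamed C.todo todoρ
        store     : C̃.store ↭ map (renAtom ρ) C.store ++ K₂
        built     : ∀ M σ → Sat M σ C̃.built ⇔ (Sat M (σ ∘ ρ) C.built × Sat M σ f)
        fvBuilt   : ∀ {y} → y ∈ fvBuiltIn C̃.built → y ∈ map ρ (fvBuiltIn C.built) ⊎ y ∈ fvBuiltIn f

      fv : ∀ {y} → y ∈ fvConfig c̃ → y ∈ map ρ (fvConfig c) ⊎ y ∈ fvConfig ⟨ G₂ , K₂ , f ⟩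
      fv y∈ with ∈-++⁻ (fvConstraints C̃.todo) y∈
      ... | inj₁ y∈todo with concatMap-++⁻ fvConstraint todoρ G₂ (concatMap-resp-↭ fvConstraint todo y∈todo)
      ...   | inj₂ y∈G₂ = inj₂ (∈-++⁺ˡ y∈G₂)
      ...   | inj₁ y∈ρ with _ , x∈ , refl ← ∈-map⁻ ρ (Renamed-fv pointwise y∈ρ) = inj₁ (∈-map⁺ ρ (∈-++⁺ˡ x∈))
      fv y∈ | inj₂ y∈rest with ∈-++⁻ (fvAtoms C̃.store) y∈rest
      ... | inj₁ y∈store with concatMap-++⁻ fvAtom (map (renAtom ρ) C.store) K₂
                                 (concatMap-resp-↭ fvAtom store y∈store)
      ...   | inj₂ y∈K₂ = inj₂ (∈-++⁺ʳ (fvConstraints G₂) (∈-++⁺ˡ y∈K₂))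
      ...   | inj₁ y∈ρ with _ , x∈ , refl ← ∈-map⁻ ρ (subst (_ ∈_) (fvAtoms-ren ρ C.store) y∈ρ) =
        inj₁ (∈-map⁺ ρ (∈-++⁺ʳ (fvConstraints C.todo) (∈-++⁺ˡ x∈)))
      fv y∈ | inj₂ y∈rest | inj₂ y∈built with fvBuilt y∈built
      ... | inj₂ y∈f = inj₂ (∈-++⁺ʳ (fvConstraints G₂) (∈-++⁺ʳ (fvAtoms K₂) y∈f))
      ... | inj₁ y∈ρ with _ , x∈ , refl ← ∈-map⁻ ρ y∈ρ =
        inj₁ (∈-map⁺ ρ (∈-++⁺ʳ (fvConstraints C.todo) (∈-++⁺ʳ (fvAtoms C.store) x∈)))

    open Simulates

    -- A variable of the fresh rule lies outside `V`, so `away` keeps its image off `V′` and the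
    -- context; injectivity keeps it off the renamed part of the configuration.
    fresh-Simulates : ∀ {c c̃ r} → Simulates c c̃ → Disjoint (fvRule r) (V ++ fvConfig c) →
                      Disjoint (fvRule (renRule ρ r)) (V′ ++ fvConfig c̃)
    fresh-Simulates {r = r} sim disj (y∈r , y∈) with x , x∈ , refl ← ∈-map⁻ ρ (fvRule-ren ρ r y∈r)
      with ∈-++⁻ V′ y∈
    ... | inj₁ y∈V′ = away (λ x∈V → disj (x∈ , ∈-++⁺ˡ x∈V)) (∈-++⁺ˡ y∈V′)
    ... | inj₂ y∈c̃ with fv sim y∈c̃
    ...   | inj₂ y∈ctx = away (λ x∈V → disj (x∈ , ∈-++⁺ˡ x∈V)) (∈-++⁺ʳ V′ y∈ctx)
    ...   | inj₁ y∈c with x′ , x′∈ , eq ← ∈-map⁻ ρ y∈c =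
      disj (x∈ , ∈-++⁺ʳ V (subst (_∈ _) (sym (inj eq)) x′∈))

    -- Applicability is monotone in the store: `d̃` implies the renamed `d`, whatever `f` adds.
    applicable-ren : ∀ {r e d d̃} → (∀ M σ → Sat M σ d̃ ⇔ (Sat M (σ ∘ ρ) d × Sat M σ f)) →
                     Applicable CT r e d → Applicable CT (renRule ρ r) (renBuiltIn ρ e) d̃
    applicable-ren {r} {e} equiv app M model σ s =
      subst (Holds M σ) (cong₂ (λ xs c → ∃ᶠ* xs (⌜ renBuiltIn ρ e ⌝ ∧ᶠ ⌜ c ⌝))
                               (sym (fvAtoms-ren ρ (heads r))) (sym (⋀-ren ρ (guard r))))
        (∃ᶠ*-ren M inj (λ _ → refl) (fvAtoms (heads r)) (e ∧ ⋀ (guard r))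
          (app M model (σ ∘ ρ) (proj₁ (Equivalence.to (equiv M σ) s))))

    store-split : ∀ {K̃ K₀} H K → K̃ ↭ map (renAtom ρ) K₀ ++ K₂ → K₀ ↭ H ++ K →
                  K̃ ↭ map (renAtom ρ) H ++ map (renAtom ρ) K ++ K₂
    store-split H K p q = ↭-trans p (↭-trans (++⁺ʳ K₂ (map⁺ (renAtom ρ) q))
      (↭-reflexive (≡-trans (cong (_++ K₂) (map-++ (renAtom ρ) H K)) (++-assoc (map (renAtom ρ) H) _ K₂))))

    Simulates-fire : ∀ {G K₀ d G̃ K̃₀ d̃ K K̃} b e → Simulates ⟨ G , K₀ , d ⟩ ⟨ G̃ , K̃₀ , d̃ ⟩ →
      K̃ ↭ map (renAtom ρ) K ++ K₂ →
      Simulates ⟨ b ++ G , K , e ∧ d ⟩ ⟨ map (renConstraint ρ) b ++ G̃ , K̃ , renBuiltIn ρ e ∧ d̃ ⟩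
    Simulates-fire {G = G} {d = d} b e sim p = record
      { todo      = ↭-trans (++⁺ˡ b̃ (todo sim)) (↭-reflexive (sym (++-assoc b̃ _ G₂)))
      ; pointwise = bodies b
      ; store     = p
      ; built     = λ M σ → mk⇔
          (λ (se , sd̃) → let sd , sf = Equivalence.to (built sim M σ) sd̃ in (Sat-ren⁻ M inj e se , sd) , sf)
          (λ ((se , sd) , sf) → Sat-ren⁺ M inj e se , Equivalence.from (built sim M σ) (sd , sf))
      ; fvBuilt   = λ {y} y∈ →
          [ (λ y∈e → inj₁ (subst (y ∈_) fv-∧ (∈-++⁺ˡ (fvBuiltIn-ren ρ e y∈e))))
          , (λ y∈d̃ → Sum.map₁ (subst (y ∈_) fv-∧ ∘ ∈-++⁺ʳ (map ρ (fvBuiltIn e))) (fvBuilt sim y∈d̃)) ]′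
          (∈-++⁻ (fvBuiltIn (renBuiltIn ρ e)) y∈)
      }
      where
      b̃    = map (renConstraint ρ) b
      fv-∧ = sym (map-++ ρ (fvBuiltIn e) (fvBuiltIn d))

      bodies : ∀ b → Pointwise Renamed (b ++ G) (map (renConstraint ρ) b ++ todoρ sim)
      bodies []      = pointwise sim
      bodies (c ∷ b) = renConstraint-Renamed c ∷ bodies b

    simulate-step : ∀ {c c′ c̃} → Step CT rs V c c′ → Simulates c c̃ →
                    ∃[ c̃′ ] Step CT rs V′ c̃ c̃′ × Simulates c′ c̃′
    simulate-step {c̃ = ⟨ G̃ , K̃ , d̃ ⟩} (solve {d′ = d′} p equiv) sim
      with _ , q , builtin {c̃ = c̃} sem fvc ∷ rels ← permute-Pointwise (pointwise sim) p =
      _ , solve (↭-trans (todo sim) (++⁺ʳ G₂ q)) equiṽ , record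
        { todo = refl ; pointwise = rels ; store = store sim ; built = built′ ; fvBuilt = fvBuilt′ }
      where
      -- Solve allows any store equivalent to the conjunction; `renBuiltIn ρ d′ ∧ f` is the one that
      -- still separates the simulated run from its context.
      built′ : ∀ M σ → Sat M σ (renBuiltIn ρ d′ ∧ f) ⇔ (Sat M (σ ∘ ρ) d′ × Sat M σ f)
      built′ M σ = mk⇔ (λ (s , sf) → Sat-ren⁻ M inj d′ s , sf) (λ (s , sf) → Sat-ren⁺ M inj d′ s , sf)

      fvBuilt′ : ∀ {y} → y ∈ fvBuiltIn (renBuiltIn ρ d′ ∧ f) → y ∈ map ρ (fvBuiltIn d′) ⊎ y ∈ fvBuiltIn f
      fvBuilt′ y∈ = Sum.map₁ (fvBuiltIn-ren ρ d′) (∈-++⁻ (fvBuiltIn (renBuiltIn ρ d′)) y∈)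

      equiṽ : CT ⊨ ⌜ c̃ ⌝ ∧ᶠ ⌜ d̃ ⌝ ⇔ᶠ ⌜ renBuiltIn ρ d′ ∧ f ⌝
      equiṽ M model σ =
        (λ (sc , sd̃) → let sd , sf = Equivalence.to (built sim M σ) sd̃ in
          Equivalence.from (built′ M σ) (proj₁ (equiv M model (σ ∘ ρ)) (Equivalence.to (sem M σ) sc , sd) , sf)) ,
        (λ s → let sd′ , sf = Equivalence.to (built′ M σ) s
                   sc , sd = proj₂ (equiv M model (σ ∘ ρ)) sd′ in
          Equivalence.from (sem M σ) sc , Equivalence.from (built sim M σ) (sd , sf))
    simulate-step (introduce p) sim
      with _ , q , user {h} ∷ rels ← permute-Pointwise (pointwise sim) p =
      _ , introduce (↭-trans (todo sim) (++⁺ʳ G₂ q)) , record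
        { todo = refl ; pointwise = rels ; store = prep _ (store sim) ; built = built sim ; fvBuilt = fvBuilt sim }
    simulate-step (simplify {H′ = H′} {K} {e = e} {r} v k p m app) sim =
      _ , simplify (FreshVariant-ren v inj (fresh-Simulates {r = r} sim (FreshVariant.fresh v))) k
            (store-split H′ K (store sim) p) (≗↦-ren ρ m) (applicable-ren {r} {e} (built sim) app) ,
      Simulates-fire (body r) e sim refl
    simulate-step (propagate {H′ = H′} {K} {e = e} {r} v k p m app) sim =
      _ , propagate (FreshVariant-ren v inj (fresh-Simulates {r = r} sim (FreshVariant.fresh v))) k
            (store-split H′ K (store sim) p) (≗↦-ren ρ m) (applicable-ren {r} {e} (built sim) app) ,
      Simulates-fire (body r) e sim (↭-sym (store-split H′ K refl refl))

    simulate : ∀ {c c′ c̃} → Star (Step CT rs V) c c′ → Simulates c c̃ →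
               ∃[ c̃′ ] Star (Step CT rs V′) c̃ c̃′ × Simulates c′ c̃′
    simulate ε        sim = _ , ε , sim
    simulate (s ◅ ss) sim
      with _ , s̃ , sim′ ← simulate-step s sim
      with _ , ss̃ , sim″ ← simulate ss sim′ = _ , s̃ ◅ ss̃ , sim″

-- Merging copies of a derivation with local variables kept apart.

module Separation (S : Signature) where
  open Signature S
  open CHR S
  open Semantics S
  open Derivations S

  bound : List Var → ℕ
  bound xs = suc (max 0 xs)

  ∈⇒<bound : ∀ {xs x} → x ∈ xs → x < bound xs
  ∈⇒<bound {xs} x∈ = s≤s (All.lookup (xs≤max 0 xs) x∈)

  shift-∉ : ∀ {xs x} → bound xs + x ∉ xs
  shift-∉ {xs} {x} ∈xs = m+n≮m (bound xs) x (∈⇒<bound ∈xs)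

  -- Answers are not closed over the variables in `V`, so all copies must share them; every other
  -- variable is local to its copy and moves to `N` or beyond.
  shiftOutside : List Var → ℕ → Var → Var
  shiftOutside V N x with x ∈? V
  ... | yes _ = x
  ... | no _  = N + x

  shiftOutside-∈ : ∀ {V N x} → x ∈ V → shiftOutside V N x ≡ x
  shiftOutside-∈ {V} {N} {x} x∈ with x ∈? V
  ... | yes _  = refl
  ... | no  x∉ = contradiction x∈ x∉

  shiftOutside-∉ : ∀ {V N x} → x ∉ V → shiftOutside V N x ≡ N + x
  shiftOutside-∉ {V} {N} {x} x∉ with x ∈? V
  ... | yes x∈ = contradiction x∈ x∉
  ... | no  _  = refl

  shiftOutside-injective : ∀ {V N} → (∀ {x} → x ∈ V → x < N) → Injective _≡_ _≡_ (shiftOutside V N)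
  shiftOutside-injective {V} {N} V<N {x} {y} eq with x ∈? V | y ∈? V
  ... | yes _  | yes _  = eq
  ... | yes x∈ | no _   = contradiction (subst (_< N) eq (V<N x∈)) (m+n≮m N y)
  ... | no _   | yes y∈ = contradiction (subst (_< N) (sym eq) (V<N y∈)) (m+n≮m N x)
  ... | no _   | no _   = +-cancelˡ-≡ N x y eq

  -- With visible variables V, the answer K ∧ d is equivalent to h₀, …, h₀ (k
  -- times).
  record Copies (CT : Theory) (V : List Var) (h₀ : Atom) (k : ℕ) (K : List Atom) (d : BuiltIn) : Set₁ where
    field
      size        : length K ≡ k
      satisfiable : ∀ M → Model CT M → (σ : Valuation M) → ¬ ¬ (∃[ τ ] (∀ {x} → x ∈ V → τ x ≡ σ x) × Sat M τ d)
      determined  : ∀ M → Model CT M → (σ τ : Valuation M) → (∀ {x} → x ∈ V → τ x ≡ σ x) → Sat M τ d →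
                    ¬ ¬ All (λ h → ground M τ h ≡ ground M σ h₀) K

  open Copies

  -- One more copy of the run: `G` is still waiting, `K` and `d` are what earlier copies left
  -- behind. As `N` exceeds all their variables, the shifted local variables of the new copy collide
  -- with none of them.
  module Merge
    {CT rs V h₀ A K₁ d₁} (A⊆V : ∀ {x} → x ∈ fvConstraints A → x ∈ V)
    (derivation : Star (Step CT rs V) ⟨ A , [] , true ⟩ ⟨ [] , K₁ , d₁ ⟩)
    (copies₁ : Copies CT V h₀ 1 K₁ d₁) (V′ : List Var)
    {G̃ G K d k} (p : G̃ ↭ A ++ G) (copies : Copies CT V h₀ k K d)
    (N : ℕ) (bounded : ∀ {x} → x ∈ V ++ V′ ++ fvConfig ⟨ G , K , d ⟩ → x < N) where

    private
      ρ = shiftOutside V N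

    V<N : ∀ {x} → x ∈ V → x < N
    V<N = bounded ∘ ∈-++⁺ˡ

    away : ∀ {x} → x ∉ V → ρ x ∉ V′ ++ fvConfig ⟨ G , K , d ⟩
    away {x} x∉ ρx∈ = m+n≮m N x (bounded (∈-++⁺ʳ V (subst (_∈ _) (shiftOutside-∉ {N = N} x∉) ρx∈)))

    open Simulation CT rs V V′ ρ (shiftOutside-injective V<N) G K d away

    start : Simulates ⟨ A , [] , true ⟩ ⟨ G̃ , K , d ⟩
    start = record
      { todo      = p
      ; pointwise = fixed A A⊆V
      ; store     = refl
      ; built     = λ M σ → mk⇔ (λ s → tt , s) proj₂
      ; fvBuilt   = inj₂
      }
      where
      fixed : ∀ A → (∀ {x} → x ∈ fvConstraints A → x ∈ V) → Pointwise Renamed A A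
      fixed []      A⊆V = []
      fixed (c ∷ A) A⊆V =
        fixed-Renamed c (λ x∈ → shiftOutside-∈ {N = N} (A⊆V (∈-++⁺ˡ x∈)))
          ∷ fixed A (A⊆V ∘ ∈-++⁺ʳ (fvConstraint c))

    merge : ∃[ G′ ] ∃[ K′ ] ∃[ d′ ] G′ ↭ G × Star (Step CT rs V′) ⟨ G̃ , K , d ⟩ ⟨ G′ , K′ , d′ ⟩ ×
                                    Copies CT V h₀ (suc k) K′ d′
    merge with ⟨ G′ , K′ , d′ ⟩ , steps , sim ← simulate derivation start
          with [] ← Simulates.pointwise sim =
      G′ , K′ , d′ , Simulates.todo sim , steps , record
        { size        = begin
            length K′                                   ≡⟨ ↭-length (Simulates.store sim) ⟩
            length (map (renAtom ρ) K₁ ++ K)            ≡⟨ length-++ (map (renAtom ρ) K₁) ⟩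
            length (map (renAtom ρ) K₁) + length K      ≡⟨ cong₂ _+_ (length-map (renAtom ρ) K₁) (size copies) ⟩
            length K₁ + k                               ≡⟨ cong (_+ k) (size copies₁) ⟩
            suc k                                       ∎
        ; satisfiable = satisfiable′
        -- New atoms are read under `τ ∘ ρ`, old ones under `τ`; both valuations agree with `σ` on
        -- `V`, which `ρ` fixes.
        ; determined  = λ M model σ τ agree s k →
            let s₁ , s₂ = Equivalence.to (Simulates.built sim M τ) s in
            determined copies₁ M model σ (τ ∘ ρ) (agree-ρ τ agree) s₁ λ all₁ →
            determined copies M model σ τ agree s₂ λ all₂ →
            k (All-resp-↭ (↭-sym (Simulates.store sim))
                (Allₚ.++⁺ (Allₚ.map⁺ (All.map (λ {h} eq → ≡-trans (ground-ren M ρ h) eq) all₁)) all₂))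
        }
      where
      open ≡-Reasoning

      agree-ρ : ∀ {C : Set} {σ : Var → C} τ → (∀ {x} → x ∈ V → τ x ≡ σ x) → ∀ {x} → x ∈ V → τ (ρ x) ≡ σ x
      agree-ρ τ agree x∈ = ≡-trans (cong τ (shiftOutside-∈ {N = N} x∈)) (agree x∈)

      satisfiable′ : ∀ M → Model CT M → ∀ σ → ¬ ¬ (∃[ τ ] (∀ {x} → x ∈ V → τ x ≡ σ x) × Sat M τ d′)
      satisfiable′ M model σ k =
        satisfiable copies₁ M model σ λ (τ₁ , agree₁ , s₁) →
        satisfiable copies M model σ λ (τ₂ , agree₂ , s₂) →
        let τ = glue τ₁ τ₂ in
        k ( τ
          , (λ x∈ → ≡-trans (glue-< τ₁ τ₂ (V<N x∈)) (agree₂ x∈))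
          , Equivalence.from (Simulates.built sim M τ)
              ( Sat-cong M d₁ (λ {x} _ → sym (glue-ρ τ₁ τ₂ (λ x∈ → ≡-trans (agree₂ x∈) (sym (agree₁ x∈))) x)) s₁
              , Sat-cong M d (λ x∈ → sym (glue-< τ₁ τ₂ (bounded
                  (∈-++⁺ʳ V (∈-++⁺ʳ V′ (∈-++⁺ʳ (fvConstraints G) (∈-++⁺ʳ (fvAtoms K) x∈))))))) s₂ ) )
        where
        -- The new and the old built-ins can share only variables of `V`, where `τ₁` and `τ₂`
        -- coincide. All of `V` lies below `N`, so everything from `N` on is free to carry `τ₁`,
        -- shifted back.
        glue : (τ₁ τ₂ : Valuation M) → Valuation M
        glue τ₁ τ₂ x with x <? N
        ... | yes _ = τ₂ x
        ... | no _  = τ₁ (x ∸ N)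

        glue-< : ∀ τ₁ τ₂ {x} → x < N → glue τ₁ τ₂ x ≡ τ₂ x
        glue-< τ₁ τ₂ {x} x<N with x <? N
        ... | yes _   = refl
        ... | no  x≮N = contradiction x<N x≮N

        glue-+ : ∀ τ₁ τ₂ x → glue τ₁ τ₂ (N + x) ≡ τ₁ x
        glue-+ τ₁ τ₂ x with (N + x) <? N
        ... | yes N+x<N = contradiction N+x<N (m+n≮m N x)
        ... | no  _     = cong τ₁ (m+n∸m≡n N x)

        glue-ρ : ∀ τ₁ τ₂ → (∀ {x} → x ∈ V → τ₂ x ≡ τ₁ x) → ∀ x → glue τ₁ τ₂ (ρ x) ≡ τ₁ x
        glue-ρ τ₁ τ₂ agree x with x ∈? V
        ... | yes x∈ = ≡-trans (glue-< τ₁ τ₂ (V<N x∈)) (agree x∈)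
        ... | no  _  = glue-+ τ₁ τ₂ x

  merges : ∀ {CT rs V h₀ A K₁ d₁ V′} → (∀ {x} → x ∈ fvConstraints A → x ∈ V) →
    Star (Step CT rs V) ⟨ A , [] , true ⟩ ⟨ [] , K₁ , d₁ ⟩ → Copies CT V h₀ 1 K₁ d₁ →
    ∀ i {G̃ K d k} → G̃ ↭ concat (replicate i A) → Copies CT V h₀ k K d →
    ∃[ K′ ] ∃[ d′ ] Star (Step CT rs V′) ⟨ G̃ , K , d ⟩ ⟨ [] , K′ , d′ ⟩ × Copies CT V h₀ (i + k) K′ d′
  merges A⊆V derivation copies₁ zero p copies with refl ← ↭-empty-inv p = _ , _ , ε , copies
  merges {CT} {V = V} {h₀} A⊆V derivation copies₁ (suc i) {k = k} p copies
    -- The bound is computed anew for every copy, because the store has gained variables.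
    with _ , _ , _ , q , steps , copies′ ← Merge.merge A⊆V derivation copies₁ _ p copies _ ∈⇒<bound
    with K′ , d′ , steps′ , copies″ ← merges A⊆V derivation copies₁ i q copies′ =
    K′ , d′ , steps ◅◅ steps′ , subst (λ m → Copies CT V h₀ m K′ d′) (+-suc i k) copies″

  -- Transfer of applicability between final configurations.

  ∃ᶠ*-stable : ∀ M σ xs c → Stable (Holds M σ (∃ᶠ* xs ⌜ c ⌝))
  ∃ᶠ*-stable M σ []       c s   = Sat-stable M σ c s
  ∃ᶠ*-stable M σ (x ∷ xs) c s k = s λ s → s k

  predicates-ren : ∀ ρ H → map predicate (map (renAtom ρ) H) ≡ map predicate H
  predicates-ren ρ []             = refl
  predicates-ren ρ (usr p ts ∷ H) = cong (p ∷_) (predicates-ren ρ H)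

  -- A rule is renamed by x ↦ N + x and fired on the whole store.  The variables
  -- of its guard and body that are not in its head are free in the
  -- applicability condition, hence fixed by the valuation.
  fires : ∀ {CT rs V W K d} r → FreshVariant rs W r → map predicate (heads r) ≡ map predicate K →
    (∀ N M → Model CT M → ∀ σ → Sat M σ d →
       ¬ ¬ (∃[ τ ] (∀ {x} → x ∈ fvRule r → x ∉ fvAtoms (heads r) → τ x ≡ σ (N + x))
                 × map (ground M τ) (heads r) ≡ map (ground M σ) K
                 × Sat M τ (⋀ (guard r)))) →
    ∃[ c ] Step CT rs V ⟨ [] , K , d ⟩ c
  fires {CT} {rs} {V} {W} {K} {d} r variant preds witness =
    fire (kind r) refl (≗↦-total (heads r̃) K (≡-trans (predicates-ren ρ (heads r)) preds))
    where
    Z = V ++ fvConfig ⟨ [] , K , d ⟩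
    N = bound Z
    ρ = N +_
    r̃ = renRule ρ r
    xs = fvAtoms (heads r)

    inj : Injective _≡_ _≡_ ρ
    inj = +-cancelˡ-≡ N _ _

    disjoint : Disjoint (fvRule r̃) Z
    disjoint (y∈r̃ , y∈Z) with _ , _ , refl ← ∈-map⁻ ρ (fvRule-ren ρ r y∈r̃) = shift-∉ {Z} y∈Z

    -- Only shifted head variables may be changed, since the applicability condition quantifies over
    -- nothing else.
    patch : ∀ {C : Set} (σ τ : Var → C) → Var → C
    patch σ τ y with y <? N | (y ∸ N) ∈? xs
    ... | yes _ | _     = σ y
    ... | no _  | yes _ = τ (y ∸ N)
    ... | no _  | no _  = σ y

    patch-< : ∀ {C : Set} (σ τ : Var → C) {y} → y < N → patch σ τ y ≡ σ y
    patch-< σ τ {y} y<N with y <? N | (y ∸ N) ∈? xs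
    ... | yes _  | _ = refl
    ... | no y≮N | _ = contradiction y<N y≮N

    patch-∉ : ∀ {C : Set} (σ τ : Var → C) {y} → y ∉ map ρ xs → patch σ τ y ≡ σ y
    patch-∉ σ τ {y} y∉ with y <? N | (y ∸ N) ∈? xs
    ... | yes _  | _      = refl
    ... | no y≮N | yes x∈ = contradiction (subst (_∈ map ρ xs) (m+[n∸m]≡n (≮⇒≥ y≮N)) (∈-map⁺ ρ x∈)) y∉
    ... | no _   | no _   = refl

    patch-ρ : ∀ {C : Set} (σ τ : Var → C) → (∀ {x} → x ∈ fvRule r → x ∉ xs → τ x ≡ σ (ρ x)) →
              ∀ {x} → x ∈ fvRule r → patch σ τ (ρ x) ≡ τ x
    patch-ρ σ τ agree {x} x∈ with (N + x) <? N | (N + x ∸ N) ∈? xs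
    ... | yes N+x<N | _     = contradiction N+x<N (m+n≮m N x)
    ... | no _      | yes _ = cong τ (m+n∸m≡n N x)
    ... | no _      | no x∉ = sym (agree x∈ (x∉ ∘ subst (_∈ xs) (sym (m+n∸m≡n N x))))

    applicable : ∀ {e} → heads r̃ ≗ K ↦ e → Applicable CT r̃ e d
    applicable {e} m M model σ s =
      ∃ᶠ*-stable M σ (fvAtoms (heads r̃)) (e ∧ ⋀ (guard r̃)) (¬¬-map instantiate (witness N M model σ s))
      where
      instantiate : _ → Holds M σ (∃ᶠ* (fvAtoms (heads r̃)) ⌜ e ∧ ⋀ (guard r̃) ⌝)
      instantiate (τ , agree , matches , guarded) =
        ∃ᶠ*-intro M (fvAtoms (heads r̃)) (e ∧ ⋀ (guard r̃))
          (patch-∉ σ τ ∘ (_∘ subst (_ ∈_) (sym (fvAtoms-ren ρ (heads r)))))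
          ( ≗↦-complete M m eq
          , subst (Sat M σ′) (sym (⋀-ren ρ (guard r)))
              (Sat-ren⁺ M inj (⋀ (guard r))
                (Sat-cong M (⋀ (guard r))
                  (λ x∈ → sym (patch-ρ σ τ agree (∈-++⁺ʳ xs (∈-++⁺ˡ (subst (_ ∈_) (fv-⋀ (guard r)) x∈)))))
                  guarded)) )
        where
        open ≡-Reasoning
        σ′ = patch σ τ
        eq : map (ground M σ′) (heads r̃) ≡ map (ground M σ′) K
        eq = begin
          map (ground M σ′) (heads r̃)       ≡⟨ grounds-ren M ρ (heads r) ⟩
          map (ground M (σ′ ∘ ρ)) (heads r) ≡⟨ grounds-cong M (heads r) (patch-ρ σ τ agree ∘ ∈-++⁺ˡ) ⟩
          map (ground M τ) (heads r)        ≡⟨ matches ⟩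
          map (ground M σ) K                ≡⟨ grounds-cong M K (λ x∈ → sym (patch-< σ τ
                                                 (∈⇒<bound {Z} (∈-++⁺ʳ V (∈-++⁺ˡ x∈))))) ⟩
          map (ground M σ′) K               ∎

    fire : ∀ k → kind r ≡ k → ∃[ e ] heads r̃ ≗ K ↦ e → ∃[ c ] Step CT rs V ⟨ [] , K , d ⟩ c
    fire simplification k (e , m) = _ ,
      simplify {K = []} (FreshVariant-ren variant inj disjoint) k (↭-sym (++-identityʳ K)) m (applicable m)
    fire propagation    k (e , m) = _ ,
      propagate {K = []} (FreshVariant-ren variant inj disjoint) k (↭-sym (++-identityʳ K)) m (applicable m)

  -- Predicate symbols are syntactic, but a ground atom retains its symbol, so any single model
  -- reveals them. Consistency says only that models cannot be absent, hence the double negation.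
  Copies-predicates : ∀ {CT V h₀ k K d} → Consistent CT → Copies CT V h₀ k K d →
    ¬ ¬ (map predicate K ≡ replicate k (predicate h₀))
  Copies-predicates {h₀ = h₀} {K = K} consistent copies k = consistent λ M model _ →
    let σ = λ _ → Structure.nonempty M in
    satisfiable copies M model σ λ (τ , agree , s) →
    determined copies M model σ τ agree s λ all →
    k (subst (λ m → map predicate K ≡ replicate m (predicate h₀)) (size copies)
        (map-constant (All.map (λ {h} eq → ≡-trans (sym (ground-predicate M τ h))
          (≡-trans (cong proj₁ eq) (ground-predicate M σ h₀))) all)))

  -- The stores `d` and `d″` are unrelated formulas. Given `σ` satisfying `d″`, `satisfiable`
  -- provides a valuation of `d` with the same visible values; applicability yields the guard there,
  -- and `determined` gives the matched atoms and `K″` the same values. So the rule would fire on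
  -- `K″`.
  irreducible-copies : ∀ {CT rs V V′ h₀ m K d} → Consistent CT → Copies CT V h₀ m K d →
    (∀ {W r} → FreshVariant rs W r → ∃[ V″ ] ∃[ K″ ] ∃[ d″ ]
       Copies CT V″ h₀ (length (heads r)) K″ d″ × (∀ c → ¬ Step CT rs V″ ⟨ [] , K″ , d″ ⟩ c)) →
    ∀ c → ¬ Step CT rs V′ ⟨ [] , K , d ⟩ c
  irreducible-copies {CT} {rs} {V} {V′} {h₀} {m} {K} {d} consistent copies final = λ where
      c (solve p _)             → ¬x∷xs↭[] (↭-sym p)
      c (introduce p)           → ¬x∷xs↭[] (↭-sym p)
      c (simplify v _ p m app)  → unfireable v p m app
      c (propagate v _ p m app) → unfireable v p m app
    where
    unfireable : ∀ {r H K′ e} → FreshVariant rs (V′ ++ fvConfig ⟨ [] , K , d ⟩) r →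
                 K ↭ H ++ K′ → heads r ≗ H ↦ e → Applicable CT r e d → ⊥
    unfireable {r} {H} {K′} {e} v p m app with V″ , K″ , d″ , copies″ , irreducible ← final v =
      Copies-predicates consistent copies λ preds →
      Copies-predicates consistent copies″ λ preds″ →
      let _ , step = fires r v (≡-trans (heads-predicates preds) (sym preds″)) witness in irreducible _ step
      where
      heads-predicates : map predicate K ≡ replicate _ (predicate h₀) →
                         map predicate (heads r) ≡ replicate (length (heads r)) (predicate h₀)
      heads-predicates preds = begin
        map predicate (heads r)                     ≡⟨ ≗↦-predicates m ⟩
        map predicate H                             ≡⟨ map-constant (Allₚ.++⁻ˡ H (All-resp-↭ p all)) ⟩
        replicate (length H) (predicate h₀)         ≡⟨ cong (λ k → replicate k (predicate h₀)) (sym (≗↦-length m)) ⟩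
        replicate (length (heads r)) (predicate h₀) ∎
        where
        open ≡-Reasoning
        all : All (λ h → predicate h ≡ predicate h₀) K
        all = Allₚ.map⁻ (subst (All (_≡ predicate h₀)) (sym preds) (Allₚ.replicate⁺ _ refl))

      witness : ∀ N M → Model CT M → ∀ σ → Sat M σ d″ →
        ¬ ¬ (∃[ τ ] (∀ {x} → x ∈ fvRule r → x ∉ fvAtoms (heads r) → τ x ≡ σ (N + x))
                  × map (ground M τ) (heads r) ≡ map (ground M σ) K″
                  × Sat M τ (⋀ (guard r)))
      witness N M model σ s″ k =
        determined copies″ M model σ σ (λ _ → refl) s″ λ all″ →
        satisfiable copies M model σ λ (τ₁ , agree , s₁) →
        determined copies M model σ τ₁ agree s₁ λ all₁ →
        -- Rule variables do not occur in `d`, so they can be reset without falsifying it. They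
        -- receive the values of their shifted copies under `σ`, as `fires` demands for those
        -- outside the head.
        let τ₂ = override τ₁ in
        ∃ᶠ*-elim M (fvAtoms (heads r)) (e ∧ ⋀ (guard r))
          (app M model τ₂ (Sat-cong M d (λ x∈ → sym (override-∉ τ₁ (λ x∈r → FreshVariant.fresh v
            (x∈r , ∈-++⁺ʳ V′ (∈-++⁺ʳ (fvAtoms K) x∈))))) s₁))
          λ (τ , outside , se , sg) →
        ≗↦-sound M m se λ matches →
        k ( τ
          , (λ x∈ x∉ → ≡-trans (outside x∉) (override-∈ τ₁ x∈))
          , (begin
               map (ground M τ) (heads r)             ≡⟨ matches ⟩
               map (ground M τ) H                     ≡⟨ grounds-cong M H (λ x∈ →
                                                           ≡-trans (outside (H∩r x∈ ∘ ∈-++⁺ˡ))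
                                                                   (override-∉ τ₁ (H∩r x∈))) ⟩
               map (ground M τ₁) H                    ≡⟨ map-constant (Allₚ.++⁻ˡ H (All-resp-↭ p all₁)) ⟩
               replicate (length H) (ground M σ h₀)   ≡⟨ cong (λ k → replicate k (ground M σ h₀))
                                                           (sym (≡-trans (size copies″) (≗↦-length m))) ⟩
               replicate (length K″) (ground M σ h₀)  ≡⟨ map-constant all″ ⟨
               map (ground M σ) K″                    ∎)
          , sg )
        where
        open ≡-Reasoning

        H∩r : ∀ {x} → x ∈ fvAtoms H → x ∉ fvRule r
        H∩r x∈H x∈r = FreshVariant.fresh v (x∈r , ∈-++⁺ʳ V′ (∈-++⁺ˡ
          (concatMap-resp-↭ fvAtom (↭-sym p) (subst (_ ∈_) (sym (concatMap-++ fvAtom H K′)) (∈-++⁺ˡ x∈H)))))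

        override : Valuation M → Valuation M
        override τ x with x ∈? fvRule r
        ... | yes _ = σ (N + x)
        ... | no _  = τ x

        override-∈ : ∀ τ {x} → x ∈ fvRule r → override τ x ≡ σ (N + x)
        override-∈ τ {x} x∈ with x ∈? fvRule r
        ... | yes _ = refl
        ... | no x∉ = contradiction x∈ x∉

        override-∉ : ∀ τ {x} → x ∉ fvRule r → override τ x ≡ τ x
        override-∉ τ {x} x∉ with x ∈? fvRule r
        ... | yes x∈ = contradiction x∈ x∉
        ... | no _   = refl

-- The one-rule source program and its answers.

module Encoding (S : Signature) where
  open Signature S
  open CHR S
  open Semantics S
  open Derivations S
  open Separation S

  -- Equivalent answers hold of the same multisets. Testing with k values of `h₀` gives the size and
  -- satisfiability of the target answer; testing with the values that `K` takes under `τ` shows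
  -- that these are all the value of `h₀`.
  Copies-answer : ∀ {CT k h₀ K d V K₀} → Consistent CT → V ≡ fvConstraints (map user (replicate k h₀)) →
    K₀ ↭ replicate k h₀ → ∀ {V′} → AnswerEquiv CT (∃₋ V K₀ true) (∃₋ V′ K d) → Copies CT V′ h₀ k K d
  Copies-answer {CT} {k} {h₀} {K} {d} {V} {K₀} consistent refl p {V′} equiv = record
    { size        = decidable-stable (length K ≟ k) λ ≢k → consistent λ M model σ →
        target M model σ λ (_ , _ , _ , q) → ≢k (≡-trans (sym (length-map _ K))
          (≡-trans (↭-length q) (length-replicate k)))
    ; satisfiable = λ M model σ k′ → target M model σ λ (τ , agree , s , _) → k′ (τ , (λ x∈ → agree x∈) , s)
    ; determined  = λ M model σ τ agree s → ¬¬-map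
        (λ (_ , agree₀ , _ , q) → Allₚ.map⁻ {P = _≡ ground M σ h₀} (All-resp-↭ q (Allₚ.map⁺ (All-resp-↭ (↭-sym p)
          (All.tabulate (fixed M agree₀))))))
        (Equivalence.from (equiv M model σ (map (ground M τ) K)) λ k → k (τ , agree , s , refl))
    }
    where
    target : ∀ M → Model CT M → ∀ σ → HoldsOf M σ (replicate k (ground M σ h₀)) (∃₋ V′ K d)
    target M model σ = Equivalence.to (equiv M model σ _) λ k′ →
      k′ (σ , (λ _ → refl) , tt ,
          ↭-trans (Perm.map⁺ (ground M σ) p) (↭-reflexive (map-replicate (ground M σ) k h₀)))

    -- The membership `h∈` is what makes the variables of `h₀` visible: for k = 0 the goal has none.
    fixed : ∀ M {σ τ h} → (∀ {x} → x ∈ V → τ x ≡ σ x) → h ∈ replicate k h₀ → ground M τ h ≡ ground M σ h₀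
    fixed M {σ} {τ} {h} agree h∈ = ≡-trans
      (ground-cong M h λ x∈ → agree (∈-concatMap⁺ fvConstraint (Any.map (λ { refl → x∈ }) (∈-map⁺ user h∈))))
      (cong (ground M σ) (All.lookup {P = _≡ h₀} (Allₚ.replicate⁺ k refl) h∈))

  introduce-all : ∀ {CT rs V d} hs K → Star (Step CT rs V) ⟨ map user hs , K , d ⟩ ⟨ [] , hs ʳ++ K , d ⟩
  introduce-all []       K = ε
  introduce-all (h ∷ hs) K = introduce refl ◅ introduce-all hs (h ∷ K)

  FreshVariant-length : ∀ {rs W r} (v : FreshVariant rs W r) →
                        length (heads r) ≡ length (heads (FreshVariant.original v))
  FreshVariant-length v =
    ≡-trans (cong (length ∘ heads) renamed) (length-map (renAtom ρ) (heads original))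
    where open FreshVariant v

  erase : ℕ → Atom → Rule
  erase n h₀ = record { kind = simplification ; head = h₀ ∷ replicate n h₀ ; guard = [] ; body = [] }

  module _ (CT : Theory) (n : ℕ) (h₀ : Atom) where

    erase-final : ∀ {k V d} → k ≤ n → ∀ {K} → length K ≡ k → ∀ c → ¬ Step CT [ erase n h₀ ] V ⟨ [] , K , d ⟩ c
    erase-final {k} k≤n {K} lenK = λ where
        c (solve p _)             → ¬x∷xs↭[] (↭-sym p)
        c (introduce p)           → ¬x∷xs↭[] (↭-sym p)
        c (simplify v _ p m app)  → tooShort v p m
        c (propagate v _ p m app) → tooShort v p m
      where
      open ≤-Reasoning
      tooShort : ∀ {W r H K′ e} → FreshVariant [ erase n h₀ ] W r → K ↭ H ++ K′ → heads r ≗ H ↦ e → ⊥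
      tooShort {r = r} {H} {K′} v p m with here refl ← FreshVariant.member v = n≮n n (begin
        suc n                             ≡⟨ cong suc (length-replicate n) ⟨
        length (heads (erase n h₀))       ≡⟨ FreshVariant-length v ⟨
        length (heads r)                  ≡⟨ ≗↦-length m ⟩
        length H                          ≤⟨ m≤m+n (length H) (length K′) ⟩
        length H + length K′              ≡⟨ length-++ H ⟨
        length (H ++ K′)                  ≡⟨ ↭-length p ⟨
        length K                          ≡⟨ lenK ⟩
        k                                 ≤⟨ k≤n ⟩
        n                                 ∎)

    erase-answer : ∀ {k} → k ≤ n → let G = map user (replicate k h₀) in
                   QA CT [ erase n h₀ ] G (∃₋ (fvConstraints G) (reverse (replicate k h₀)) true)
    erase-answer {k} k≤n = refl , introduce-all (replicate k h₀) [] ,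
      erase-final k≤n (≡-trans (↭-length (↭-reverse (replicate k h₀))) (length-replicate k))

    -- With an empty body no step can create an atom, only move or delete copies of `h₀`.
    erase-invariant : ∀ {V c c′} → Star (Step CT [ erase n h₀ ] V) c c′ →
      All (_≡ user h₀) (Config.todo c) → All (_≡ h₀) (Config.store c) → All (_≡ h₀) (Config.store c′)
    erase-invariant ε _ all = all
    erase-invariant (solve p _ ◅ ss) todo store with () ∷ _ ← All-resp-↭ p todo
    erase-invariant (introduce p ◅ ss) todo store with refl ∷ todo′ ← All-resp-↭ p todo =
      erase-invariant ss todo′ (refl ∷ store)
    erase-invariant (simplify {H′ = H} v _ p _ _ ◅ ss) todo store
      with record { member = here refl ; renamed = refl } ← v =
      erase-invariant ss todo (Allₚ.++⁻ʳ H (All-resp-↭ p store))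
    erase-invariant (propagate v k _ _ _ ◅ ss) todo store
      with record { member = here refl ; renamed = refl } ← v
      with () ← k

    erase-fires : ∀ {V K d} → All (_≡ h₀) K → length K ≡ suc n →
                  ∃[ c ] Step CT [ erase n h₀ ] V ⟨ [] , K , d ⟩ c
    erase-fires {V} {K} {d} all lenK =
      -- The identity variant with nothing to avoid suffices, because `fires` performs the renaming
      -- apart. The store is literally the head, so `σ` serves as its own witness below.
      fires {W = []} (renRule id (erase n h₀))
        record { original = _ ; member = here refl ; ρ = id ; injective = id ; renamed = refl ; fresh = λ () }
        (≡-trans (predicates-ren id hs) (cong (map predicate) (sym K≡)))
        λ N M _ σ _ k → k
          ( σ
          , (λ x∈ x∉ → [ (λ x∈hs → contradiction x∈hs x∉) , (λ ()) ]′ (∈-++⁻ (fvAtoms (map (renAtom id) hs)) x∈))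
          , ≡-trans (grounds-ren M id hs) (cong (map (ground M σ)) (sym K≡))
          , tt )
      where
      hs = replicate (suc n) h₀

      K≡ : K ≡ hs
      K≡ = ≡-trans (≡-trans (sym (map-id K)) (map-constant all)) (cong (λ k → replicate k h₀) lenK)

    -- The number of atoms alone will separate source from target: a store of n + 1 atoms would
    -- consist of copies of `h₀`, and the rule would still fire.
    erase-length : ∀ {G V K d} → All (_≡ user h₀) G → QA CT [ erase n h₀ ] G (∃₋ V K d) → length K ≢ suc n
    erase-length todo (_ , steps , final) lenK =
      let c , step = erase-fires (erase-invariant steps todo []) lenK in final c step

-- The contradiction for an arbitrary encoding.

corollary5p3 : ∀ {ℓ} (S : Signature) → let open CHR S in
    (CT : Theory) → Consistent CT →
    (Πₛ Πₜ : UserPreds) → ∃ Πₛ →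
    (n : ℕ) → n > 1 →
    (𝒢 : Goal Πₛ → Set ℓ) → ContainsSubheads Πₛ (suc n) 𝒢 →
    ¬ AcceptableEncoding CT Πₛ Πₜ (suc n) n 𝒢
corollary5p3 S CT consistent Πₛ Πₜ (p , p∈Πₛ) n n>1 𝒢 subheads enc = contradictory
  where
  open Signature S
  open CHR S
  open Semantics S
  open Derivations S
  open Separation S
  open Encoding S
  open AcceptableEncoding enc

  h₀ : Atom
  -- A variable is the one term that exists over every signature.
  h₀ = usr p (Vec.replicate (userAr p) (var 0))

  erase-wf : RuleOf Πₛ (suc n) (erase n h₀)
  erase-wf = record
    { headOver = usr p∈Πₛ ∷ Allₚ.replicate⁺ n (usr p∈Πₛ)
    ; bodyOver = []
    ; headSize = s≤s (≤-reflexive (length-replicate n))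
    }

  P : Program Πₛ (suc n)
  P = record { rules = [ erase n h₀ ] ; wf = erase-wf ∷ [] }

  Q : Program Πₜ n
  Q = ⟦ P ⟧

  copies : ℕ → Goal Πₛ
  copies k = goal (map user (replicate k h₀)) (Allₚ.map⁺ (Allₚ.replicate⁺ k (user (usr p∈Πₛ))))

  copies∈𝒢 : ∀ {k} → k ≤ suc n → 𝒢 (copies k)
  copies∈𝒢 {k} k≤ = subheads (erase n h₀) erase-wf (copies k) (map user (replicate (suc n ∸ k) h₀))
    (↭-reflexive (≡-trans (sym (map-++ user (replicate k h₀) _))
      (cong (map user) (≡-trans (sym (replicate-+ k (suc n ∸ k))) (cong (λ m → replicate m h₀) (m+[n∸m]≡n k≤))))))
    where
    replicate-+ : ∀ i j → replicate (i + j) h₀ ≡ replicate i h₀ ++ replicate j h₀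
    replicate-+ zero    j = refl
    replicate-+ (suc i) j = cong (h₀ ∷_) (replicate-+ i j)

  encoded : ℕ → List Constraint
  encoded k = constraints ⟦ copies k ⟧ᵍ

  A : List Constraint
  A = encoded 1

  encoded-suc : ∀ k → encoded (suc k) ↭ A ++ encoded k
  encoded-suc k = ↭-trans (multiset (copies (suc k)) (copies 1 ⊕ copies k) refl)
                          (compositional (copies 1) (copies k))

  -- The empty goal is the sum of two empty goals, so the length of its encoding is its own double.
  encoded-0 : encoded 0 ≡ []
  encoded-0 = empty (encoded 0) (↭-trans (multiset (copies 0) (copies 0 ⊕ copies 0) refl)
                                     (compositional (copies 0) (copies 0)))
    where
    empty : ∀ {A : Set} (xs : List A) → xs ↭ xs ++ xs → xs ≡ []
    empty []       _ = refl
    empty (x ∷ xs) p = contradiction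
      (≡-trans (≡-trans (↭-length p) (length-++ (x ∷ xs))) (+-suc (suc (length xs)) (length xs)))
      (m≢1+m+n (suc (length xs)))

  encoded-concat : ∀ k → encoded k ↭ concat (replicate k A)
  encoded-concat zero    = ↭-reflexive encoded-0
  encoded-concat (suc k) = ↭-trans (encoded-suc k) (++⁺ˡ A (encoded-concat k))

  answer : ∀ {k} → k ≤ n → let V = fvConstraints (encoded k) in
    ∃[ K ] ∃[ d ] QA CT (rules Q) (encoded k) (∃₋ V K d) × Copies CT V h₀ k K d
  answer {k} k≤n
    with ∃₋ V K d , qa@(refl , _) , equiv ← proj₁ (preservesAnswers P (copies k) (copies∈𝒢 (m≤n⇒m≤1+n k≤n))) _
           (erase-answer CT n h₀ k≤n) =
    K , d , qa , Copies-answer consistent refl (↭-reverse (replicate k h₀)) equiv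

  V V′ : List Var
  V  = fvConstraints A
  V′ = fvConstraints (encoded (suc n))

  -- Merging keeps the visible variables of a single copy, whereas the final answer is read with
  -- those of the whole goal; the copies being alike, the latter add nothing.
  V′⊆V : ∀ {x} → x ∈ V′ → x ∈ V
  V′⊆V x∈ = concat-⊆ (suc n) (concatMap-resp-↭ fvConstraint (encoded-concat (suc n)) x∈)
    where
    concat-⊆ : ∀ k {x} → x ∈ fvConstraints (concat (replicate k A)) → x ∈ V
    concat-⊆ (suc k) x∈ = [ id , concat-⊆ k ]′ (concatMap-++⁻ fvConstraint A (concat (replicate k A)) x∈)

  none : Copies CT V h₀ 0 [] true
  none = record
    { size        = refl
    ; satisfiable = λ M _ σ k → k (σ , (λ _ → refl) , tt)
    ; determined  = λ _ _ _ _ _ _ k → k []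
    }

  small : ∀ {W r} → FreshVariant (rules Q) W r → ∃[ V″ ] ∃[ K″ ] ∃[ d″ ]
    Copies CT V″ h₀ (length (heads r)) K″ d″ × (∀ c → ¬ Step CT (rules Q) V″ ⟨ [] , K″ , d″ ⟩ c)
  small v with K″ , d″ , (_ , _ , final) , copies″ ← answer (subst (_≤ n) (sym (FreshVariant-length v))
    (RuleOf.headSize (All.lookup (Program.wf Q) (FreshVariant.member v)))) =
    _ , K″ , d″ , copies″ , final

  -- In a model where one of two equivalent answers is satisfiable, a common multiset forces equally
  -- many atoms on both sides.
  too-many : ∀ {K d Kₛ Vₛ dₛ} → Copies CT V h₀ (suc n + 0) K d → length Kₛ ≢ suc n →
             ¬ AnswerEquiv CT (∃₋ V′ K d) (∃₋ Vₛ Kₛ dₛ)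
  too-many {K} {Kₛ = Kₛ} copiesₙ size≢ equiv = consistent λ M model σ →
    Copies.satisfiable copiesₙ M model σ λ (τ , agree , s) →
    Equivalence.to (equiv M model σ (map (ground M τ) K)) (λ k → k (τ , (λ x∈ → agree (V′⊆V x∈)) , s , refl))
      λ (_ , _ , _ , q) → size≢
        (≡-trans (sym (length-map _ Kₛ)) (≡-trans (↭-length q)
          (≡-trans (length-map _ K) (≡-trans (Copies.size copiesₙ) (+-identityʳ (suc n))))))

  unpreserved : ∀ {K d} → Star (Step CT (rules Q) V′) ⟨ encoded (suc n) , [] , true ⟩ ⟨ [] , K , d ⟩ →
                Copies CT V h₀ (suc n + 0) K d → ⊥
  unpreserved {K} {d} steps copiesₙ =
    let ∃₋ _ _ _ , qaₛ , equiv = proj₂ (preservesAnswers P (copies (suc n)) (copies∈𝒢 ≤-refl)) (∃₋ V′ K d)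
          (refl , steps , irreducible-copies consistent copiesₙ small)
    in too-many copiesₙ (erase-length CT n h₀ (Allₚ.map⁺ (Allₚ.replicate⁺ (suc n) refl)) qaₛ) equiv

  contradictory : ⊥
  contradictory =
    -- From the answer for one copy the derivation is taken and its finality dropped; from the
    -- answers in `small` it is the reverse.
    let _ , _ , (_ , steps₁ , _) , copies₁ = answer (<⇒≤ n>1)
        _ , _ , steps , copiesₙ = merges id steps₁ copies₁ (suc n) (encoded-concat (suc n)) none
    in unpreserved steps copiesₙ
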